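{- Let $G=(V,E)$ be an undirected graph, $k$ a positive integer, and $f:V\to\mathbb{Z}\cup\{ -\infty\}$, $g:V\to\mathbb{Z}\cup\{+\infty\}$ with $f\le g$. A $k$-edge-connected $(f,g)$-bounded orientation $D$ of $G$ is decreasingly minimal among all $k$-edge-connected $(f,g)$-bounded orientations of $G$ if and only if there are no two nodes $s,t$ for which $\varrho_D(t)\ge\varrho_D(s)+2$, $\varrho_D(t)>f(t)$, $\varrho_D(s)<g(s)$, and $D$ contains $k+1$ arc-disjoint directed paths from $s$ to $t$.
   Context: $\varrho_D(v)$ is the number of arcs with head $v$; $D$ is $(f,g)$-bounded if $f(v)\le\varrho_D(v)\le g(v)$ for all $v$; $D$ is $k$-edge-connected if every non-empty proper subset of $V$ has at least $k$ entering arcs. Decreasingly minimal: in-degree vector with largest component as small as possible within the class, then second largest, etc. -}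

module Defs where

open import Data.Fin using (Fin)
import Data.Fin as Fin
open import Data.Fin.Subset using (Subset; Nonempty; _⊂_; ⊤)
open import Data.Fin.Subset.Properties using (_∈?_)
open import Data.Integer using (ℤ; +_)
import Data.Integer as ℤ
open import Data.List using (List; []; _∷_; length; filter; map; allFin)
open import Data.List.Relation.Binary.Disjoint.Propositional using (Disjoint)
open import Data.List.Relation.Binary.Lex.Strict using (Lex-≤)
import Data.List.Sort as Sort
open import Data.List.Relation.Unary.Unique.Propositional using (Unique)
open import Data.Nat using (ℕ; _≤_; _<_)
import Data.Nat.Properties as ℕₚ
open import Data.Product using (Σ-syntax; _×_; _,_; proj₁)
open import Data.Sum using (_⊎_)
import Data.Unit as Unit
open import Relation.Binary.Construct.Add.Infimum.NonStrict ℤ._≤_ public using (_≤₋_)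
open import Relation.Binary.Construct.Add.Infimum.Strict ℤ._<_ public using (_<₋_)
open import Relation.Binary.Construct.Add.Supremum.NonStrict ℤ._≤_ public using (_≤⁺_)
open import Relation.Binary.Construct.Add.Supremum.Strict ℤ._<_ public using (_<⁺_)
import Relation.Binary.Properties.DecTotalOrder as DTO
open import Relation.Binary.PropositionalEquality using (_≡_; _≢_)
open import Relation.Nullary.Construct.Add.Infimum using (_₋; ⊥₋; [_])
open import Relation.Nullary.Construct.Add.Supremum using (_⁺; ⊤⁺)
open import Relation.Nullary.Decidable using (¬?; _×-dec_)

-- Parallel edges and loops are allowed.  The order of the two ends of an
-- edge carries no information: see _IsOrientationOf_.
record Graph (n m : ℕ) : Set where
  field
    ends : Fin m → Fin n × Fin n

record Digraph (n m : ℕ) : Set where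
  field
    tail : Fin m → Fin n
    head : Fin m → Fin n

_IsOrientationOf_ : ∀ {n m} → Digraph n m → Graph n m → Set
D IsOrientationOf G = ∀ e → (ends e ≡ (tail e , head e)) ⊎ (ends e ≡ (head e , tail e))
  where
  open Graph G
  open Digraph D

module _ {n m : ℕ} (D : Digraph n m) where

  open Digraph D

  ϱ : Fin n → ℕ
  ϱ v = length (filter (λ e → head e Fin.≟ v) (allFin m))

  entering : Subset n → ℕ
  entering X = length (filter (λ e → (head e ∈? X) ×-dec ¬? (tail e ∈? X)) (allFin m))

  EdgeConnected : ℕ → Set
  EdgeConnected k = ∀ (X : Subset n) → Nonempty X → X ⊂ ⊤ → k ≤ entering X

  Bounded : (Fin n → ℤ ₋) → (Fin n → ℤ ⁺) → Set
  Bounded f g = ∀ v → (f v ≤₋ [ + ϱ v ]) × ([ + ϱ v ] ≤⁺ g v)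

  data Walk : Fin n → Fin n → Set where
    nil  : ∀ {v} → Walk v v
    cons : ∀ {t} (e : Fin m) → Walk (head e) t → Walk (tail e) t

  arcs : ∀ {s t} → Walk s t → List (Fin m)
  arcs nil        = []
  arcs (cons e w) = e ∷ arcs w

  nodes : ∀ {s t} → Walk s t → List (Fin n)
  nodes (nil {v})  = v ∷ []
  nodes (cons e w) = tail e ∷ nodes w

  Path : Fin n → Fin n → Set
  Path s t = Σ[ w ∈ Walk s t ] Unique (nodes w)

  ArcDisjointPaths : ℕ → Fin n → Fin n → Set
  ArcDisjointPaths l s t =
    Σ[ P ∈ (Fin l → Path s t) ]
      (∀ i j → i ≢ j → Disjoint (arcs (proj₁ (P i))) (arcs (proj₁ (P j))))

_≤∞_ : ℤ ₋ → ℤ ⁺ → Set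
⊥₋    ≤∞ b     = Unit.⊤
[ a ] ≤∞ ⊤⁺    = Unit.⊤
[ a ] ≤∞ [ b ] = a ℤ.≤ b

sort↓ : List ℕ → List ℕ
sort↓ = Sort.sort (DTO.≥-decTotalOrder ℕₚ.≤-decTotalOrder)

-- x is decreasingly smaller than, or value-equivalent to, y.
_≤dec_ : ∀ {n} → (Fin n → ℕ) → (Fin n → ℕ) → Set
_≤dec_ {n} x y = Lex-≤ _≡_ _<_ (sort↓ (map x (allFin n))) (sort↓ (map y (allFin n)))

DecMin : ∀ {n m} → (Digraph n m → Set) → Digraph n m → Set
DecMin C D = C D × (∀ D′ → C D′ → ϱ D ≤dec ϱ D′)

record Feasible {n m} (G : Graph n m) (k : ℕ) (f : Fin n → ℤ ₋) (g : Fin n → ℤ ⁺)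
                (D : Digraph n m) : Set where
  field
    isOrientation : D IsOrientationOf G
    edgeConnected : EdgeConnected D k
    bounded       : Bounded D f g

{-# OPTIONS --safe #-}

-- Work with the vectors x = ϱ D.  A set is tight if it is entered by exactly k arcs; tight sets
-- form a crossing family, and by Menger's theorem there are k + 1 arc-disjoint paths from s to t
-- iff no tight set contains t but not s.  Reversing one of these paths moves one unit of
-- in-degree from t to s and keeps D k-edge-connected, which gives necessity.
--
-- For sufficiency, let y be the in-degree vector of a competitor.  All that is used of y is that
-- it has the same sum as x and that y(X) ≥ x(X) for the tight sets X of D.  If y(u) < x(u), an
-- uncrossing argument finds v with y(v) > x(v) such that no tight set separates u from v and
-- y + e_u − e_v still satisfies these inequalities.  The hypothesis on D gives x(u) ≤ x(v) + 1,
-- hence y(u) + 1 ≤ x(u) ≤ x(v) + 1 ≤ y(v), so that y + e_u − e_v is decreasingly not larger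
-- than y, and it is closer to x.
module Submission where

open import Defs
open import Data.Nat using (ℕ; suc; _+_; _≤_; _≥_)
open import Data.Fin using (Fin)
open import Data.Product using (_×_; ∃-syntax)
open import Function.Bundles using (_⇔_)
open import Relation.Nullary using (¬_)
open import Relation.Nullary.Construct.Add.Infimum using (_₋; [_])
open import Relation.Nullary.Construct.Add.Supremum using (_⁺)

open import Data.Bool using (Bool; true; false; if_then_else_; _∧_; _∨_; not; _xor_)
import Data.Bool.Properties as Boolₚ
open import Data.Fin using (zero; suc)
import Data.Fin as Fin
import Data.Fin.Properties as Finₚ
open import Data.Fin.Subset using (Subset)
import Data.Fin.Subset as Subset
import Data.Fin.Subset.Properties as Subsetₚ
import Data.Integer as ℤ
import Data.Integer.Properties as ℤₚ
open import Data.List using (List; []; _∷_; length; filter; map; tabulate; allFin)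
import Data.List as List
import Data.List.Membership.DecPropositional as DecMembership
open import Data.List.Membership.Propositional using (_∈_)
open import Data.List.Membership.Propositional.Properties using (∈-allFin; ∈-filter⁺)
import Data.List.Properties as Listₚ
open import Data.List.Relation.Binary.Disjoint.Propositional using (Disjoint)
open import Data.List.Relation.Binary.Lex.Strict using (Lex-≤; base; halt; this; next)
import Data.List.Relation.Binary.Lex.Strict as Lex
open import Data.List.Relation.Binary.Permutation.Propositional.Properties using (↭-length; filter-↭)
import Data.List.Relation.Binary.Pointwise as Pointwise
open import Data.List.Relation.Unary.All using (All; []; _∷_)
import Data.List.Relation.Unary.All as All
import Data.List.Relation.Unary.All.Properties as Allₚ
open import Data.List.Relation.Unary.AllPairs using (AllPairs; []; _∷_)
open import Data.List.Relation.Unary.Any using (here; there; index)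
import Data.List.Relation.Unary.Any.Properties as Anyₚ
import Data.List.Relation.Unary.Sorted.TotalOrder.Properties as Sortedₚ
open import Data.List.Relation.Unary.Unique.Propositional using (Unique)
import Data.List.Sort as Sort
open import Data.Nat using (zero; pred; _*_; _∸_; _<_; _≤?_; _<?_; z≤n; s≤s; >-nonZero)
import Data.Nat.ListAction as ListAction
import Data.Nat.Properties as ℕₚ
open import Data.Nat.Solver using (module +-*-Solver)
open import Data.Product using (Σ-syntax; _,_; proj₁; proj₂)
open import Data.Sum using (_⊎_; inj₁; inj₂)
import Data.Vec as Vec
import Data.Vec.Properties as Vecₚ
open import Function using (_∘_; id)
open import Function.Bundles using (mk⇔)
open import Relation.Binary using (DecTotalOrder; tri<; tri≈; tri>)
import Relation.Binary.Construct.Add.Infimum.NonStrict ℤ._≤_ as ≤₋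
open import Relation.Binary.Construct.Add.Infimum.Strict ℤ._<_ using (⊥₋<[_]; [_])
import Relation.Binary.Construct.Add.Supremum.NonStrict ℤ._≤_ as ≤⁺
import Relation.Binary.Construct.Add.Supremum.Strict ℤ._<_ as <⁺
import Relation.Binary.Properties.DecTotalOrder as DTO
open import Relation.Binary.PropositionalEquality
open import Relation.Nullary using (Dec; yes; no; does; contradiction)
open import Relation.Nullary.Decidable using (dec-true; dec-false; ¬?; _×-dec_; _⊎-dec_; map′; decidable-stable)
open import Relation.Unary using (Decidable)

open import Algebra.Lattice.Properties.BooleanAlgebra Boolₚ.∨-∧-booleanAlgebra using (deMorgan₁; deMorgan₂)
open import Algebra.Properties.CommutativeMonoid.Sum ℕₚ.+-0-commutativeMonoid
  using (sum; sum-cong-≗; sum-replicate-zero; ∑-distrib-+; ∑-comm)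
open +-*-Solver using (solve; con; _:+_; _:*_; _:=_)

-- Sums over Fin n

⟦_⟧ : Bool → ℕ
⟦ b ⟧ = if b then 1 else 0

sum-mono-≤ : ∀ {n} {f g : Fin n → ℕ} → (∀ i → f i ≤ g i) → sum f ≤ sum g
sum-mono-≤ {zero}  f≤g = z≤n
sum-mono-≤ {suc n} f≤g = ℕₚ.+-mono-≤ (f≤g zero) (sum-mono-≤ (f≤g ∘ suc))

sum-mono-< : ∀ {n} {f g : Fin n → ℕ} → (∀ i → f i ≤ g i) → ∀ i → f i < g i → sum f < sum g
sum-mono-< f≤g zero    lt = ℕₚ.+-mono-<-≤ lt (sum-mono-≤ (f≤g ∘ suc))
sum-mono-< f≤g (suc i) lt = ℕₚ.+-mono-≤-< (f≤g zero) (sum-mono-< (f≤g ∘ suc) i lt)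

sum-+-cong : ∀ {n} (f g h k : Fin n → ℕ) → (∀ i → f i + g i ≡ h i + k i) → sum f + sum g ≡ sum h + sum k
sum-+-cong f g h k eq = trans (sym (∑-distrib-+ f g)) (trans (sum-cong-≗ eq) (∑-distrib-+ h k))

sum-+-mono-≤ : ∀ {n} (f g h k : Fin n → ℕ) → (∀ i → f i + g i ≤ h i + k i) → sum f + sum g ≤ sum h + sum k
sum-+-mono-≤ f g h k le = subst₂ _≤_ (∑-distrib-+ f g) (∑-distrib-+ h k) (sum-mono-≤ le)

sum-0 : ∀ {n} {f : Fin n → ℕ} → (∀ i → f i ≡ 0) → sum f ≡ 0
sum-0 {n} f≡0 = trans (sum-cong-≗ f≡0) (sum-replicate-zero n)

sum-≤⇒≗ : ∀ {n} {f g : Fin n → ℕ} → (∀ i → f i ≤ g i) → sum f ≡ sum g → f ≗ g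
sum-≤⇒≗ {f = f} {g} f≤g eq i with f i ℕₚ.≟ g i
... | yes p = p
... | no ¬p = contradiction eq (ℕₚ.<⇒≢ (sum-mono-< f≤g i (ℕₚ.≤∧≢⇒< (f≤g i) ¬p)))

sum-δ : ∀ {n} (i : Fin n) (c : Fin n → ℕ) → sum (λ j → if does (i Fin.≟ j) then c j else 0) ≡ c i
sum-δ {suc n} zero c = trans (cong (c zero +_) (sum-replicate-zero n)) (ℕₚ.+-identityʳ _)
sum-δ (suc i) c = sum-δ i (c ∘ suc)

-- Each side adds the two entries that the other sum has at `s` and `t`. Spread out by Kronecker
-- deltas, the identity holds summand by summand and needs no subtraction.
sum-update₂ : ∀ {n} {f g : Fin n → ℕ} (s t : Fin n) → s ≢ t → (∀ i → i ≢ s → i ≢ t → f i ≡ g i) →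
              sum f + (g s + g t) ≡ sum g + (f s + f t)
sum-update₂ {n} {f} {g} s t s≢t f≡g = trans (sym (split f g)) (trans (sum-cong-≗ pointwise) (split g f))
  where
  at : Fin n → (Fin n → ℕ) → Fin n → ℕ
  at i h j = if does (i Fin.≟ j) then h j else 0

  split : ∀ f g → sum (λ i → f i + (at s g i + at t g i)) ≡ sum f + (g s + g t)
  split f g = begin
    sum (λ i → f i + (at s g i + at t g i))     ≡⟨ ∑-distrib-+ f _ ⟩
    sum f + sum (λ i → at s g i + at t g i)     ≡⟨ cong (sum f +_) (∑-distrib-+ (at s g) (at t g)) ⟩
    sum f + (sum (at s g) + sum (at t g))       ≡⟨ cong (sum f +_) (cong₂ _+_ (sum-δ s g) (sum-δ t g)) ⟩
    sum f + (g s + g t)                         ∎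
    where open ≡-Reasoning

  pointwise : ∀ i → f i + (at s g i + at t g i) ≡ g i + (at s f i + at t f i)
  pointwise i with s Fin.≟ i | t Fin.≟ i
  ... | yes refl | yes refl = contradiction refl s≢t
  ... | yes refl | no _     = solve 2 (λ a b → a :+ (b :+ con 0) := b :+ (a :+ con 0)) refl (f i) (g i)
  ... | no _     | yes refl = ℕₚ.+-comm (f i) (g i)
  ... | no s≢i   | no t≢i   = cong (_+ 0) (f≡g i (s≢i ∘ sym) (t≢i ∘ sym))

length-filter-tabulate : ∀ {A : Set} {P : A → Set} (P? : Decidable P) {n} (f : Fin n → A) →
                         length (filter P? (tabulate f)) ≡ sum (λ i → ⟦ does (P? (f i)) ⟧)
length-filter-tabulate P? {zero}  f = refl
length-filter-tabulate P? {suc n} f with does (P? (f zero))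
... | true  = cong suc (length-filter-tabulate P? (f ∘ suc))
... | false = length-filter-tabulate P? (f ∘ suc)

-- The decreasing order

private
  module ≥O = DecTotalOrder (DTO.≥-decTotalOrder ℕₚ.≤-decTotalOrder)
  module S  = Sort (DTO.≥-decTotalOrder ℕₚ.≤-decTotalOrder)

count≥ : ℕ → List ℕ → ℕ
count≥ c xs = length (filter (c ≤?_) xs)

count≥-∷ : ∀ c x xs → count≥ c (x ∷ xs) ≡ ⟦ does (c ≤? x) ⟧ + count≥ c xs
count≥-∷ c x xs with does (c ≤? x)
... | true  = refl
... | false = refl

count≥-∷-yes : ∀ {c x} → c ≤ x → ∀ xs → count≥ c (x ∷ xs) ≡ suc (count≥ c xs)
count≥-∷-yes {c} {x} c≤x xs = trans (count≥-∷ c x xs) (cong (λ b → ⟦ b ⟧ + count≥ c xs) (dec-true (c ≤? x) c≤x))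

count≥-above : ∀ {c xs} → All (_< c) xs → count≥ c xs ≡ 0
count≥-above {c} xs<c = cong length (Listₚ.filter-none (c ≤?_) (All.map ℕₚ.<⇒≱ xs<c))

-- At the largest c where p and q differ, p is the smaller one.
Dominated : (ℕ → ℕ) → (ℕ → ℕ) → Set
Dominated p q = ∀ c → q c < p c → ∃[ c′ ] (c < c′ × p c′ < q c′)

-- Equal heads contribute the same to every count and cancel. If the head `a` of `p` exceeded the
-- head `b` of `q`, then at threshold `a` the count of `p` would be positive and that of `q` zero;
-- no larger threshold could make up for this, as `q` has nothing above `b`.
lex-≤-from-counts : ∀ {p q} → AllPairs _≥_ p → AllPairs _≥_ q →
                    Dominated (λ c → count≥ c p) (λ c → count≥ c q) → Lex-≤ _≡_ _<_ p q
lex-≤-from-counts {[]}    {[]}    _ _ _ = base _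
lex-≤-from-counts {[]}    {_ ∷ _} _ _ _ = halt
lex-≤-from-counts {a ∷ p} {[]}    _ _ H with H 0 (s≤s z≤n)
... | _ , _ , ()
lex-≤-from-counts {a ∷ p} {b ∷ q} (a≥p ∷ p↘) (b≥q ∷ q↘) H with ℕₚ.<-cmp a b
... | tri< a<b _ _    = this a<b
... | tri≈ _ refl _   = next refl (lex-≤-from-counts p↘ q↘ H′)
  where
  H′ : Dominated (λ c → count≥ c p) (λ c → count≥ c q)
  H′ c lt with H c (subst₂ _<_ (sym (count≥-∷ c a q)) (sym (count≥-∷ c a p)) (ℕₚ.+-monoʳ-< ⟦ does (c ≤? a) ⟧ lt))
  ... | c′ , c<c′ , lt′ = c′ , c<c′ ,
        ℕₚ.+-cancelˡ-< ⟦ does (c′ ≤? a) ⟧ _ _ (subst₂ _<_ (count≥-∷ c′ a p) (count≥-∷ c′ a q) lt′)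
... | tri> _ _ b<a = let c′ , a<c′ , lt = witness in contradiction (subst (count≥ c′ (a ∷ p) <_) (none a<c′) lt) ℕₚ.n≮0
  where
  none : ∀ {c} → a < c → count≥ c (b ∷ q) ≡ 0
  none a<c = count≥-above (ℕₚ.<-trans b<a a<c ∷ All.map (λ b≥x → ℕₚ.≤-<-trans b≥x (ℕₚ.<-trans b<a a<c)) b≥q)
  witness : ∃[ c′ ] (a < c′ × count≥ c′ (a ∷ p) < count≥ c′ (b ∷ q))
  witness = H a (subst₂ _<_ (sym (count≥-above {a} (b<a ∷ All.map (λ b≥x → ℕₚ.≤-<-trans b≥x b<a) b≥q)))
                            (sym (count≥-∷-yes {a} ℕₚ.≤-refl p)) (s≤s z≤n))

values : ∀ {n} → (Fin n → ℕ) → List ℕ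
values {n} x = map x (allFin n)

#≥ : ∀ {n} → (Fin n → ℕ) → ℕ → ℕ
#≥ x c = sum (λ i → ⟦ does (c ≤? x i) ⟧)

count≥-sort↓ : ∀ {n} (x : Fin n → ℕ) c → count≥ c (sort↓ (values x)) ≡ #≥ x c
count≥-sort↓ x c = begin
  count≥ c (sort↓ (values x))  ≡⟨ ↭-length (filter-↭ (c ≤?_) (S.sort-↭ (values x))) ⟩
  count≥ c (values x)          ≡⟨ cong (count≥ c) (Listₚ.map-tabulate id x) ⟩
  count≥ c (tabulate x)        ≡⟨ length-filter-tabulate (c ≤?_) x ⟩
  #≥ x c                       ∎
  where open ≡-Reasoning

sort↓-sorted : ∀ xs → AllPairs _≥_ (sort↓ xs)
sort↓-sorted xs = Sortedₚ.Sorted⇒AllPairs ≥O.totalOrder (S.sort-↗ xs)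

≤dec-from-counts : ∀ {n} {x y : Fin n → ℕ} → Dominated (#≥ x) (#≥ y) → x ≤dec y
≤dec-from-counts {x = x} {y} H = lex-≤-from-counts (sort↓-sorted _) (sort↓-sorted _) H′
  where
  H′ : Dominated (λ c → count≥ c (sort↓ (values x))) (λ c → count≥ c (sort↓ (values y)))
  H′ c lt with H c (subst₂ _<_ (count≥-sort↓ y c) (count≥-sort↓ x c) lt)
  ... | c′ , c<c′ , lt′ = c′ , c<c′ , subst₂ _<_ (sym (count≥-sort↓ x c′)) (sym (count≥-sort↓ y c′)) lt′

-- Mutual comparison forces equal sorted lists, so the vectors agree only up to rearrangement; the
-- counts are what survives sorting.
≤dec-antisym : ∀ {n} {x y : Fin n → ℕ} → x ≤dec y → y ≤dec x → #≥ x ≗ #≥ y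
≤dec-antisym {x = x} {y} p q c =
  trans (sym (count≥-sort↓ x c)) (trans (cong (count≥ c) lists-equal) (count≥-sort↓ y c))
  where
  lists-equal : sort↓ (values x) ≡ sort↓ (values y)
  lists-equal = Pointwise.Pointwise-≡⇒≡ (Lex.≤-antisymmetric sym (λ { refl → ℕₚ.<-irrefl refl }) ℕₚ.<-asym p q)

≤dec-trans : ∀ {n} {x y z : Fin n → ℕ} → x ≤dec y → y ≤dec z → x ≤dec z
≤dec-trans = Lex.≤-transitive isEquivalence (subst (_ <_) , subst (_< _)) ℕₚ.<-trans

≤dec-reflexive : ∀ {n} {x y : Fin n → ℕ} → x ≗ y → x ≤dec y
≤dec-reflexive x≗y = Lex.≤-reflexive _≡_ _<_ (Pointwise.≡⇒Pointwise-≡ (cong sort↓ (Listₚ.map-cong x≗y _)))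

-- Moving one unit from one entry to another

record Transfer {n} (y y′ : Fin n → ℕ) (u v : Fin n) : Set where
  field
    gain  : y′ u ≡ suc (y u)
    -- The successor on the left forces `y v` to be positive and avoids truncated subtraction.
    loss  : suc (y′ v) ≡ y v
    other : ∀ w → w ≢ u → w ≢ v → y′ w ≡ y w

module _ {n} {y y′ : Fin n → ℕ} {u v : Fin n} (tr : Transfer y y′ u v) where

  open Transfer tr

  private
    ind : ℕ → ℕ → ℕ
    ind c a = ⟦ does (c ≤? a) ⟧

    ind-yes : ∀ {c a} → c ≤ a → ind c a ≡ 1
    ind-yes {c} {a} p = cong ⟦_⟧ (dec-true (c ≤? a) p)

    ind-no : ∀ {c a} → a < c → ind c a ≡ 0
    ind-no {c} {a} p = cong ⟦_⟧ (dec-false (c ≤? a) (ℕₚ.<⇒≱ p))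

    balance : u ≢ v → ∀ c → #≥ y′ c + (ind c (y u) + ind c (y v)) ≡ #≥ y c + (ind c (suc (y u)) + ind c (y′ v))
    balance u≢v c = trans (sum-update₂ u v u≢v λ i i≢u i≢v → cong (ind c) (other i i≢u i≢v))
                          (cong (λ z → #≥ y c + (ind c z + ind c (y′ v))) gain)

    -- At the threshold `y v` the entry at `v` falls out of the count, while `suc (y u)` is still
    -- too small to enter it.
    top-drops : suc (y u) < y v → #≥ y′ (y v) < #≥ y (y v)
    top-drops lt = ℕₚ.≤-reflexive (begin
      suc (#≥ y′ (y v))                                           ≡⟨ ℕₚ.+-comm 1 _ ⟩
      #≥ y′ (y v) + (0 + 1)
        ≡⟨ cong (#≥ y′ (y v) +_) (cong₂ _+_ (sym (ind-no (ℕₚ.<-trans (ℕₚ.n<1+n _) lt))) (sym (ind-yes {y v} ℕₚ.≤-refl))) ⟩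
      #≥ y′ (y v) + (ind (y v) (y u) + ind (y v) (y v))           ≡⟨ balance u≢v (y v) ⟩
      #≥ y (y v) + (ind (y v) (suc (y u)) + ind (y v) (y′ v))
        ≡⟨ cong (#≥ y (y v) +_) (cong₂ _+_ (ind-no lt) (ind-no (ℕₚ.≤-reflexive loss))) ⟩
      #≥ y (y v) + 0                                              ≡⟨ ℕₚ.+-identityʳ _ ⟩
      #≥ y (y v)                                                  ∎)
      where
      open ≡-Reasoning
      u≢v : u ≢ v
      u≢v refl = ℕₚ.<-asym lt (ℕₚ.n<1+n _)

  -- A count can rise only at a threshold `c` with `y u < c ≤ y′ v`: for smaller `c` both old
  -- entries are counted already, and above `y′ v` a gain at `u` is paid for by the loss at `v`. For
  -- such a `c` the count at the larger threshold `y v` drops.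
  transfer-≤dec : y u < y v → y′ ≤dec y
  transfer-≤dec u<v = ≤dec-from-counts dominated
    where
    u≢v : u ≢ v
    u≢v refl = ℕₚ.<-irrefl refl u<v

    ind-≤1 : ∀ c a → ind c a ≤ 1
    ind-≤1 c a with does (c ≤? a)
    ... | true  = ℕₚ.≤-refl
    ... | false = z≤n

    no-rise : ∀ c → ind c (suc (y u)) + ind c (y′ v) ≤ ind c (y u) + ind c (y v) → ¬ (#≥ y c < #≥ y′ c)
    no-rise c le lt = ℕₚ.<-irrefl (sym (balance u≢v c)) (ℕₚ.+-mono-<-≤ lt le)

    dominated : Dominated (#≥ y′) (#≥ y)
    dominated c rise with c ≤? y u
    ... | yes c≤u = contradiction rise (no-rise c (subst (ind c (suc (y u)) + ind c (y′ v) ≤_)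
                      (sym (cong₂ _+_ (ind-yes c≤u) (ind-yes (ℕₚ.≤-trans c≤u (ℕₚ.<⇒≤ u<v)))))
                      (ℕₚ.+-mono-≤ (ind-≤1 c _) (ind-≤1 c _))))
    ... | no c≰u with c ≤? y′ v
    ...   | no c≰v′ = contradiction rise (no-rise c (subst₂ _≤_
                        (cong (ind c (suc (y u)) +_) (sym (ind-no (ℕₚ.≰⇒> c≰v′)))) refl low))
      where
      low : ind c (suc (y u)) + 0 ≤ ind c (y u) + ind c (y v)
      low with c ≤? suc (y u)
      ... | yes p = subst (ind c (suc (y u)) + 0 ≤_) (cong (ind c (y u) +_) (sym (ind-yes (ℕₚ.≤-trans p u<v))))
                      (ℕₚ.≤-trans (ℕₚ.≤-reflexive (ℕₚ.+-identityʳ _)) (ℕₚ.≤-trans (ind-≤1 c _) (ℕₚ.m≤n+m 1 _)))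
      ... | no ¬p = subst (λ z → z + 0 ≤ ind c (y u) + ind c (y v)) (sym (ind-no (ℕₚ.≰⇒> ¬p))) z≤n
    ...   | yes c≤v′ = y v , c<v , top-drops (ℕₚ.≤-<-trans (ℕₚ.≰⇒> c≰u) c<v)
      where
      c<v : c < y v
      c<v = subst (c <_) loss (s≤s c≤v′)

  -- A comparison in the other direction would make all counts equal, contrary to the drop at the
  -- threshold `y v`.
  transfer-strict : suc (y u) < y v → ¬ (y ≤dec y′)
  transfer-strict lt y≤y′ = ℕₚ.<-irrefl (sym (≤dec-antisym {x = y} {y′} y≤y′ (transfer-≤dec (ℕₚ.<-trans (ℕₚ.n<1+n _) lt)) (y v)))
                                        (top-drops lt)

-- Node sets as characteristic functions

NodeSet : ℕ → Set
NodeSet n = Fin n → Bool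

infixr 6 _∪_
infixr 7 _∩_
infixl 7 _∖_

_∪_ _∩_ _∖_ : ∀ {n} → NodeSet n → NodeSet n → NodeSet n
(A ∪ B) v = A v ∨ B v
(A ∩ B) v = A v ∧ B v
(A ∖ B) v = A v ∧ not (B v)

∁ : ∀ {n} → NodeSet n → NodeSet n
∁ A v = not (A v)

_∣_ : ∀ {n} → (Fin n → ℕ) → NodeSet n → Fin n → ℕ
(x ∣ A) v = if A v then x v else 0

weight : ∀ {n} → (Fin n → ℕ) → NodeSet n → ℕ
weight x A = sum (x ∣ A)

weight-cong : ∀ {n} (x : Fin n → ℕ) {A B : NodeSet n} → A ≗ B → weight x A ≡ weight x B
weight-cong x A≗B = sum-cong-≗ (λ v → cong (if_then x v else 0) (A≗B v))

weight-∅ : ∀ {n} (x : Fin n → ℕ) {A : NodeSet n} → (∀ v → A v ≡ false) → weight x A ≡ 0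
weight-∅ x A≡∅ = sum-0 (λ v → cong (if_then x v else 0) (A≡∅ v))

weight-modular : ∀ {n} (x : Fin n → ℕ) (A B : NodeSet n) →
                 weight x (A ∪ B) + weight x (A ∩ B) ≡ weight x A + weight x B
weight-modular x A B = sum-+-cong (x ∣ (A ∪ B)) (x ∣ (A ∩ B)) (x ∣ A) (x ∣ B) (λ v → pointwise (A v) (B v) (x v))
  where
  pointwise : ∀ a b c → (if a ∨ b then c else 0) + (if a ∧ b then c else 0) ≡ (if a then c else 0) + (if b then c else 0)
  pointwise false b     c = ℕₚ.+-identityʳ _
  pointwise true  false c = refl
  pointwise true  true  c = refl

weight-disjoint : ∀ {n} (x : Fin n → ℕ) (A B : NodeSet n) → (∀ v → A v ∧ B v ≡ false) →
                  weight x (A ∪ B) ≡ weight x A + weight x B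
weight-disjoint x A B dis = begin
  weight x (A ∪ B)                     ≡⟨ ℕₚ.+-identityʳ _ ⟨
  weight x (A ∪ B) + 0                 ≡⟨ cong (weight x (A ∪ B) +_) (weight-∅ x dis) ⟨
  weight x (A ∪ B) + weight x (A ∩ B)  ≡⟨ weight-modular x A B ⟩
  weight x A + weight x B              ∎
  where open ≡-Reasoning

weight-∁ : ∀ {n} (x : Fin n → ℕ) (A : NodeSet n) → weight x A + weight x (∁ A) ≡ sum x
weight-∁ x A = trans (sym (∑-distrib-+ (x ∣ A) (x ∣ ∁ A))) (sum-cong-≗ (λ v → pointwise (A v) (x v)))
  where
  pointwise : ∀ a c → (if a then c else 0) + (if not a then c else 0) ≡ c
  pointwise false c = refl
  pointwise true  c = ℕₚ.+-identityʳ c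

weight-mono-< : ∀ {n} {x y : Fin n → ℕ} (A : NodeSet n) → (∀ v → A v ≡ true → x v ≤ y v) →
                ∀ u → A u ≡ true → x u < y u → weight x A < weight y A
weight-mono-< {x = x} {y} A le u u∈A lt = sum-mono-< pointwise u strict
  where
  pointwise : ∀ v → (if A v then x v else 0) ≤ (if A v then y v else 0)
  pointwise v with A v in eq
  ... | true  = le v eq
  ... | false = z≤n
  strict : (if A u then x u else 0) < (if A u then y u else 0)
  strict rewrite u∈A = lt

¬true⇒false : ∀ {b} → b ≢ true → b ≡ false
¬true⇒false {false} _ = refl
¬true⇒false {true}  p = contradiction refl p

∧-true : ∀ {a b} → a ≡ true → b ≡ true → a ∧ b ≡ true
∧-true refl refl = refl

∨-false : ∀ {a b} → a ≡ false → b ≡ false → a ∨ b ≡ false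
∨-false refl refl = refl

∨-introʳ : ∀ a {b} → b ≡ true → a ∨ b ≡ true
∨-introʳ false p = p
∨-introʳ true  p = refl

∨-introˡ : ∀ {a} b → a ≡ true → a ∨ b ≡ true
∨-introˡ b refl = refl

∧-elimˡ : ∀ {a b} → a ∧ b ≡ true → a ≡ true
∧-elimˡ {true} _ = refl

∧-elimʳ : ∀ {a b} → a ∧ b ≡ true → b ≡ true
∧-elimʳ {true} p = p

∨-falseˡ : ∀ {a b} → a ∨ b ≡ false → a ≡ false
∨-falseˡ {false} _ = refl

∨-falseʳ : ∀ {a b} → a ∨ b ≡ false → b ≡ false
∨-falseʳ {false} p = p

not-true : ∀ {a} → not a ≡ true → a ≡ false
not-true {false} _ = refl

-- Disjoint unions of members of a family

disjoint? : ∀ {n} (A B : NodeSet n) → (∃[ v ] (A v ∧ B v ≡ true)) ⊎ (∀ v → A v ∧ B v ≡ false)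
disjoint? A B with Finₚ.any? (λ v → (A v ∧ B v) Boolₚ.≟ true)
... | yes p = inj₁ p
... | no ¬p = inj₂ (λ v → ¬true⇒false (λ eq → ¬p (v , eq)))

-- The blocks are pairwise disjoint, so that weights add up over them. Unions are recorded up to
-- pointwise equality because node sets are functions.
data Decomp {n} (P : NodeSet n → Set) : NodeSet n → Set where
  empty : ∀ {W} → (∀ v → W v ≡ false) → Decomp P W
  block : ∀ {W} Z W′ → P Z → Decomp P W′ → (∀ v → Z v ∧ W′ v ≡ false) → W ≗ Z ∪ W′ → Decomp P W

module _ {n} {P : NodeSet n → Set} where

  -- P is an intersecting family: overlapping blocks are merged into their union.
  decomp-insert : (∀ {A B} v → P A → P B → A v ∧ B v ≡ true → P (A ∪ B)) →
                  ∀ Z {W} → P Z → Decomp P W → ∃[ W′ ] (Decomp P W′ × W′ ≗ Z ∪ W)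
  decomp-insert merge Z {W} PZ (empty W≡∅) =
    Z ∪ W , block Z W PZ (empty W≡∅) (λ v → trans (cong (Z v ∧_) (W≡∅ v)) (Boolₚ.∧-zeroʳ _)) (λ _ → refl) , λ _ → refl
  decomp-insert merge Z {W} PZ (block Z₁ W₁ PZ₁ dec dis W≗) with disjoint? Z Z₁
  ... | inj₁ (v , meet) =
        let W′ , dec′ , W′≗ = decomp-insert merge (Z ∪ Z₁) (merge v PZ PZ₁ meet) dec
        in  W′ , dec′ , λ w → trans (W′≗ w) (trans (Boolₚ.∨-assoc (Z w) _ _) (cong (Z w ∨_) (sym (W≗ w))))
  ... | inj₂ apart =
        let W′ , dec′ , W′≗ = decomp-insert merge Z PZ dec
        in  Z₁ ∪ W′ ,
            block Z₁ W′ PZ₁ dec′ (λ w → trans (cong (Z₁ w ∧_) (W′≗ w)) (apart′ (Z w) (Z₁ w) (W₁ w) (apart w) (dis w)))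
              (λ _ → refl) ,
            λ w → trans (cong (Z₁ w ∨_) (W′≗ w)) (trans (exchange (Z w) (Z₁ w) (W₁ w)) (cong (Z w ∨_) (sym (W≗ w))))
    where
    apart′ : ∀ a b c → a ∧ b ≡ false → b ∧ c ≡ false → b ∧ (a ∨ c) ≡ false
    apart′ false b     c p q = q
    apart′ true  false c p q = refl
    exchange : ∀ a b c → b ∨ (a ∨ c) ≡ a ∨ (b ∨ c)
    exchange false b     c = refl
    exchange true  false c = refl
    exchange true  true  c = refl

  decomp-cover : (∀ {A B} v → P A → P B → A v ∧ B v ≡ true → P (A ∪ B)) →
                 {R : Fin n → Set} → (∀ v → (∃[ Z ] (P Z × Z v ≡ true)) ⊎ R v) →
                 ∃[ W ] (Decomp P W × (∀ v → W v ≡ true ⊎ R v))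
  decomp-cover merge {R} choice =
    let W , dec , cov = go (allFin n) in W , dec , λ v → cov v (∈-allFin v)
    where
    go : ∀ vs → ∃[ W ] (Decomp P W × (∀ v → v ∈ vs → W v ≡ true ⊎ R v))
    go [] = (λ _ → false) , empty (λ _ → refl) , λ _ ()
    go (v ∷ vs) with choice v | go vs
    ... | inj₂ r              | W , dec , cov = W , dec , λ { _ (here refl) → inj₂ r ; w (there p) → cov w p }
    ... | inj₁ (Z , PZ , v∈Z) | W , dec , cov with decomp-insert merge Z PZ dec
    ...   | W′ , dec′ , W′≗ = W′ , dec′ , cov′
      where
      cov′ : ∀ w → w ∈ v ∷ vs → W′ w ≡ true ⊎ R w
      cov′ w (here refl) = inj₁ (trans (W′≗ w) (∨-introˡ (W w) v∈Z))
      cov′ w (there p) with cov w p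
      ... | inj₁ w∈W = inj₁ (trans (W′≗ w) (∨-introʳ (Z w) w∈W))
      ... | inj₂ r   = inj₂ r

  decomp-avoids : ∀ {u} → (∀ {Z} → P Z → Z u ≡ false) → ∀ {W} → Decomp P W → W u ≡ false
  decomp-avoids av (empty W≡∅)              = W≡∅ _
  decomp-avoids av (block _ _ PZ dec _ W≗) = trans (W≗ _) (∨-false (av PZ) (decomp-avoids av dec))

-- Exchange in crossing families

-- The nodes `u` and `v` witness that the sets meet and that they leave something uncovered. Nested
-- sets are included: their union and intersection are the two sets themselves.
record CrossingFamily {n} (T : NodeSet n → Set) : Set where
  field
    respects : ∀ {A B} → A ≗ B → T A → T B
    ∪-closed : ∀ {A B} u v → T A → T B → A u ∧ B u ≡ true → A v ∨ B v ≡ false → T (A ∪ B)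
    ∩-closed : ∀ {A B} u v → T A → T B → A u ∧ B u ≡ true → A v ∨ B v ≡ false → T (A ∩ B)

module Exchange {n} {T : NodeSet n → Set} (crossing : CrossingFamily T)
                (x y : Fin n → ℕ) (total : sum x ≡ sum y)
                (above : ∀ {A} → T A → weight x A ≤ weight y A)
                (u : Fin n) where

  open CrossingFamily crossing

  private

    CoTight : NodeSet n → Set
    CoTight Z = T (∁ Z) × Z u ≡ false

    -- Together with `above` the inequality is an equality: `y` has no slack on such a set, so no
    -- unit may leave it towards `u`.
    DoublyTight : NodeSet n → Set
    DoublyTight Y = T Y × weight y Y ≤ weight x Y × Y u ≡ false

    -- By de Morgan, the complement of the union is the intersection of two tight sets that meet in
    -- `u` and both miss `v`. Fixing `u` thus turns a crossing family into an intersecting one.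
    cotight-merge : ∀ {A B} v → CoTight A → CoTight B → A v ∧ B v ≡ true → CoTight (A ∪ B)
    cotight-merge {A} {B} v (TA , u∉A) (TB , u∉B) meet =
      respects (λ w → sym (deMorgan₂ (A w) (B w)))
           (∩-closed u v TA TB (cong₂ (λ a b → not a ∧ not b) u∉A u∉B)
             (trans (sym (deMorgan₁ (A v) (B v))) (cong not meet))) ,
      ∨-false u∉A u∉B

    -- Weights are modular and `y` weighs at least as much as `x` on the intersection, so an excess
    -- of `y` on the union would contradict the bounds on `A` and `B`. Both sets miss `u`, so they
    -- are crossing once they meet.
    doublyTight-merge : ∀ {A B} v → DoublyTight A → DoublyTight B → A v ∧ B v ≡ true → DoublyTight (A ∪ B)
    doublyTight-merge {A} {B} v (TA , leA , u∉A) (TB , leB , u∉B) meet =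
      ∪-closed v u TA TB meet (∨-false u∉A u∉B) ,
      ℕₚ.+-cancelʳ-≤ (weight y (A ∩ B)) _ _ (begin
        weight y (A ∪ B) + weight y (A ∩ B)  ≡⟨ weight-modular y A B ⟩
        weight y A + weight y B              ≤⟨ ℕₚ.+-mono-≤ leA leB ⟩
        weight x A + weight x B              ≡⟨ weight-modular x A B ⟨
        weight x (A ∪ B) + weight x (A ∩ B)  ≤⟨ ℕₚ.+-monoʳ-≤ _ (above (∩-closed v u TA TB meet (∨-false u∉A u∉B))) ⟩
        weight x (A ∪ B) + weight y (A ∩ B)  ∎) ,
      ∨-false u∉A u∉B
      where open ℕₚ.≤-Reasoning

    -- The totals agree, so the lower bound for `y` on the tight complement is an upper bound on
    -- `Z`.
    cotight-below : ∀ {Z} → CoTight Z → weight y Z ≤ weight x Z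
    cotight-below {Z} (TZ , _) = ℕₚ.+-cancelʳ-≤ (weight x (∁ Z)) _ _ (begin
      weight y Z + weight x (∁ Z)  ≤⟨ ℕₚ.+-monoʳ-≤ _ (above TZ) ⟩
      weight y Z + weight y (∁ Z)  ≡⟨ weight-∁ y Z ⟩
      sum y                        ≡⟨ total ⟨
      sum x                        ≡⟨ weight-∁ x Z ⟨
      weight x Z + weight x (∁ Z)  ∎)
      where open ℕₚ.≤-Reasoning

    -- The blocks are disjoint, so the bounds on their parts inside `B` add up. The bound is asked
    -- only of sets inside the union, because `cut-below` depends on that inclusion.
    decomp-below : ∀ {P} (B : NodeSet n) → ∀ {W} →
                   (∀ {Z} → P Z → (∀ v → W v ≡ false → Z v ≡ false) → weight y (Z ∩ B) ≤ weight x (Z ∩ B)) →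
                   Decomp P W → weight y (W ∩ B) ≤ weight x (W ∩ B)
    decomp-below B {W} le (empty W≡∅) =
      ℕₚ.≤-trans (ℕₚ.≤-reflexive (weight-∅ y λ v → cong (_∧ B v) (W≡∅ v))) z≤n
    decomp-below B {W} le (block Z W′ PZ dec dis W≗) = begin
      weight y (W ∩ B)                      ≡⟨ split y ⟩
      weight y (Z ∩ B) + weight y (W′ ∩ B)
        ≤⟨ ℕₚ.+-mono-≤ (le PZ (λ v p → ∨-falseˡ (trans (sym (W≗ v)) p)))
             (decomp-below B (λ PZ′ sub → le PZ′ (λ v p → sub v (∨-falseʳ {Z v} (trans (sym (W≗ v)) p)))) dec) ⟩
      weight x (Z ∩ B) + weight x (W′ ∩ B)  ≡⟨ split x ⟨
      weight x (W ∩ B)                      ∎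
      where
      open ℕₚ.≤-Reasoning
      apart : ∀ a b c → a ∧ b ≡ false → (a ∧ c) ∧ (b ∧ c) ≡ false
      apart false b     c p = refl
      apart true  false c p = Boolₚ.∧-zeroʳ c
      split : ∀ z → weight z (W ∩ B) ≡ weight z (Z ∩ B) + weight z (W′ ∩ B)
      split z = trans (weight-cong z (λ v → trans (cong (_∧ B v) (W≗ v)) (Boolₚ.∧-distribʳ-∨ (B v) (Z v) (W′ v))))
                      (weight-disjoint z (Z ∩ B) (W′ ∩ B) (λ v → apart (Z v) (W′ v) (B v) (dis v)))

    -- Each set that is cut out of Z has a node outside Z, so that ∁ Z and it are crossing
    -- unless it swallows Z.
    cut-below : ∀ {W} (U : NodeSet n) → Decomp (λ Y → DoublyTight Y × ∃[ v ] (Y v ≡ true × U v ≡ false)) W →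
                ∀ Z → CoTight Z → (∀ v → U v ≡ false → Z v ≡ false) →
                weight y (Z ∖ W) ≤ weight x (Z ∖ W)
    cut-below {W} U (empty W≡∅) Z cZ _ = subst₂ _≤_ (same y) (same x) (cotight-below cZ)
      where
      same : ∀ z → weight z Z ≡ weight z (Z ∖ W)
      same z = weight-cong z (λ v → sym (trans (cong (λ b → Z v ∧ not b) (W≡∅ v)) (Boolₚ.∧-identityʳ (Z v))))
    cut-below {W} U (block Y W′ ((TY , _ , u∉Y) , v , v∈Y , v∉U) dec _ W≗) Z (TZ , u∉Z) Z⊆U
      with disjoint? Z (∁ Y)
    ... | inj₂ Z⊆Y = ℕₚ.≤-trans (ℕₚ.≤-reflexive (weight-∅ y (λ w → none (Z w) (Y w) (W w) (W′ w) (W≗ w) (Z⊆Y w)))) z≤n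
      where
      none : ∀ a b c c′ → c ≡ b ∨ c′ → a ∧ not b ≡ false → a ∧ not c ≡ false
      none false _    _ _ _    _ = refl
      none true  true _ _ refl _ = refl
    ... | inj₁ (a , a∈Z∖Y) = subst₂ _≤_ (same y) (same x) (cut-below U dec (Z ∖ Y) (T′ , cong (_∧ not (Y u)) u∉Z)
                                 (λ w w∉U → cong (_∧ not (Y w)) (Z⊆U w w∉U)))
      where
      T′ : T (∁ (Z ∖ Y))
      T′ = respects (λ w → ext (Z w) (Y w))
             (∪-closed v a TZ TY (∧-true (cong not (Z⊆U v v∉U)) v∈Y)
               (∨-false (cong not (∧-elimˡ a∈Z∖Y)) (not-true (∧-elimʳ {Z a} a∈Z∖Y))))
        where
        ext : ∀ a b → not a ∨ b ≡ not (a ∧ not b)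
        ext false b     = refl
        ext true  false = refl
        ext true  true  = refl
      same : ∀ z → weight z ((Z ∖ Y) ∖ W′) ≡ weight z (Z ∖ W)
      same z = weight-cong z (λ w → trans (ext (Z w) (Y w) (W′ w)) (cong (λ b → Z w ∧ not b) (sym (W≗ w))))
        where
        ext : ∀ a b c → (a ∧ not b) ∧ not c ≡ a ∧ not (b ∨ c)
        ext a false c = cong (_∧ not c) (Boolₚ.∧-identityʳ a)
        ext a true  c = trans (cong (_∧ not c) (Boolₚ.∧-zeroʳ a)) (sym (Boolₚ.∧-zeroʳ a))

  Separated : Fin n → Set
  Separated v = (∃[ X ] (T X × X u ≡ true × X v ≡ false))
              ⊎ (∃[ Y ] (T Y × weight y Y ≤ weight x Y × Y v ≡ true × Y u ≡ false))

  -- If every `v` with `x v < y v` were separated, these nodes would be covered by a disjoint union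
  -- `U` of co-tight sets and a disjoint union `W` of doubly tight sets. Then `y` weighs at most as
  -- much as `x` on `W` and on `U` minus `W`, and is at most `x` pointwise elsewhere, strictly at
  -- `u`. This contradicts the equality of the totals.
  exchange : y u < x u → ¬ (∀ v → x v < y v → Separated v)
  exchange u↓ sep with decomp-cover cotight-merge {λ v → x v < y v → ∃[ Y ] (DoublyTight Y × Y v ≡ true)} first
    where
    first : ∀ v → (∃[ Z ] (CoTight Z × Z v ≡ true)) ⊎ (x v < y v → ∃[ Y ] (DoublyTight Y × Y v ≡ true))
    first v with x v <? y v
    ... | no ¬p = inj₂ (λ p → contradiction p ¬p)
    ... | yes p with sep v p
    ...   | inj₁ (X , TX , u∈X , v∉X) =
            inj₁ (∁ X , (respects (λ w → sym (Boolₚ.not-involutive (X w))) TX , cong not u∈X) , cong not v∉X)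
    ...   | inj₂ (Y , TY , le , v∈Y , u∉Y) = inj₂ (λ _ → Y , (TY , le , u∉Y) , v∈Y)
  ... | U , decU , covU
    -- Only doubly tight sets with a node outside `U` are used: there such a set meets the
    -- complement of every block of `U`. Unions inherit the property, so merging preserves it.
    with decomp-cover {P = λ Y → DoublyTight Y × ∃[ v ] (Y v ≡ true × U v ≡ false)}
           (λ { {A} {B} v (a , w , w∈A , w∉U) (b , _) meet →
                doublyTight-merge v a b meet , w , ∨-introˡ (B w) w∈A , w∉U })
           {λ v → U v ≡ true ⊎ y v ≤ x v} second
    where
    second : ∀ v → (∃[ Y ] ((DoublyTight Y × ∃[ w ] (Y w ≡ true × U w ≡ false)) × Y v ≡ true))
                 ⊎ (U v ≡ true ⊎ y v ≤ x v)
    second v with x v <? y v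
    ... | no ¬p = inj₂ (inj₂ (ℕₚ.≮⇒≥ ¬p))
    ... | yes p with U v in eq | covU v
    ...   | true  | _ = inj₂ (inj₁ refl)
    ...   | false | inj₂ r with r p
    ...     | Y , dY , v∈Y = inj₁ (Y , (dY , v , v∈Y , eq) , v∈Y)
  ... | W , decW , covW = ℕₚ.<-irrefl (sym total) (begin-strict
      sum y                                  ≡⟨ weight-∁ y (W ∪ U) ⟨
      weight y (W ∪ U) + weight y (∁ (W ∪ U))  <⟨ ℕₚ.+-mono-≤-< inner outer ⟩
      weight x (W ∪ U) + weight x (∁ (W ∪ U))  ≡⟨ weight-∁ x (W ∪ U) ⟩
      sum x                                  ∎)
    where
    open ℕₚ.≤-Reasoning
    u∉ : (W ∪ U) u ≡ false
    u∉ = ∨-false (decomp-avoids (λ p → proj₂ (proj₂ (proj₁ p))) decW) (decomp-avoids proj₂ decU)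
    outer : weight y (∁ (W ∪ U)) < weight x (∁ (W ∪ U))
    outer = weight-mono-< (∁ (W ∪ U)) le u (cong not u∉) u↓
      where
      le : ∀ v → ∁ (W ∪ U) v ≡ true → y v ≤ x v
      le v v∉ with covW v
      ... | inj₂ (inj₂ p) = p
      ... | inj₁ v∈W        = contradiction (trans (sym (∨-introˡ (U v) v∈W)) (not-true v∉)) λ ()
      ... | inj₂ (inj₁ v∈U) = contradiction (trans (sym (∨-introʳ (W v) v∈U)) (not-true v∉)) λ ()
    W-below : weight y W ≤ weight x W
    W-below = subst₂ _≤_ (same y) (same x)
                (decomp-below (λ _ → true)
                  (λ {Z} (d , _) _ → subst₂ _≤_ (weight-cong y (λ v → sym (Boolₚ.∧-identityʳ (Z v))))
                                               (weight-cong x (λ v → sym (Boolₚ.∧-identityʳ (Z v)))) (proj₁ (proj₂ d)))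
                  decW)
      where
      same : ∀ z → weight z (W ∩ (λ _ → true)) ≡ weight z W
      same z = weight-cong z (λ v → Boolₚ.∧-identityʳ (W v))
    U-below : weight y (U ∖ W) ≤ weight x (U ∖ W)
    U-below = decomp-below (∁ W) (λ {Z} cZ Z⊆U → cut-below U decW Z cZ Z⊆U) decU
    inner : weight y (W ∪ U) ≤ weight x (W ∪ U)
    inner = subst₂ _≤_ (sym (split y)) (sym (split x)) (ℕₚ.+-mono-≤ W-below U-below)
      where
      split : ∀ z → weight z (W ∪ U) ≡ weight z W + weight z (U ∖ W)
      split z = trans (weight-cong z (λ v → ext (W v) (U v))) (weight-disjoint z W (U ∖ W) (λ v → apart (W v) (U v)))
        where
        ext : ∀ a b → a ∨ b ≡ a ∨ (b ∧ not a)
        ext false b = sym (Boolₚ.∧-identityʳ b)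
        ext true  b = refl
        apart : ∀ a b → a ∧ (b ∧ not a) ≡ false
        apart false b = refl
        apart true  b = Boolₚ.∧-zeroʳ b

-- Cuts and in-degrees

does-∈? : ∀ {n} v (X : Subset n) → does (v Subsetₚ.∈? X) ≡ Vec.lookup X v
does-∈? zero    (true Vec.∷ X)  = refl
does-∈? zero    (false Vec.∷ X) = refl
does-∈? (suc v) (x Vec.∷ X)     = does-∈? v X

module _ {n m} (D : Digraph n m) where

  open Digraph D

  -- This is the sum of `φ v` times the in-degree of `v`. An identity valid for all `φ` yields,
  -- through indicator functions, statements about single nodes and about node sets alike.
  headSum : (Fin n → ℕ) → ℕ
  headSum φ = sum (φ ∘ head)

  cut : NodeSet n → ℕ
  cut A = sum (λ e → ⟦ A (head e) ∧ not (A (tail e)) ⟧)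

  induced : NodeSet n → ℕ
  induced A = sum (λ e → ⟦ A (head e) ∧ A (tail e) ⟧)

  -- An arc with head in `A` has its tail either outside or inside. Since `induced` is the same for
  -- all orientations of a graph, inequalities between cuts translate into inequalities between
  -- in-degree sums.
  cut+induced : ∀ A → cut A + induced A ≡ headSum (⟦_⟧ ∘ A)
  cut+induced A = trans (sym (∑-distrib-+ (λ e → ⟦ A (head e) ∧ not (A (tail e)) ⟧) (λ e → ⟦ A (head e) ∧ A (tail e) ⟧)))
                        (sum-cong-≗ λ e → pointwise (A (head e)) (A (tail e)))
    where
    pointwise : ∀ a b → ⟦ a ∧ not b ⟧ + ⟦ a ∧ b ⟧ ≡ ⟦ a ⟧
    pointwise false b     = refl
    pointwise true  false = refl
    pointwise true  true  = refl

  cut-cong : ∀ {A B} → A ≗ B → cut A ≡ cut B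
  cut-cong A≗B = sum-cong-≗ λ e → cong₂ (λ a b → ⟦ a ∧ not b ⟧) (A≗B (head e)) (A≗B (tail e))

  -- The inequality holds arc by arc; it is strict for arcs joining `A` minus `B` with `B` minus
  -- `A`.
  cut-submodular : ∀ A B → cut (A ∪ B) + cut (A ∩ B) ≤ cut A + cut B
  cut-submodular A B = sum-+-mono-≤ (arc (A ∪ B)) (arc (A ∩ B)) (arc A) (arc B)
                         λ e → pointwise (A (head e)) (A (tail e)) (B (head e)) (B (tail e))
    where
    arc : NodeSet n → Fin m → ℕ
    arc A e = ⟦ A (head e) ∧ not (A (tail e)) ⟧
    pointwise : ∀ a a′ b b′ → ⟦ (a ∨ b) ∧ not (a′ ∨ b′) ⟧ + ⟦ (a ∧ b) ∧ not (a′ ∧ b′) ⟧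
                            ≤ ⟦ a ∧ not a′ ⟧ + ⟦ b ∧ not b′ ⟧
    pointwise false false b     b′    = ℕₚ.≤-reflexive (ℕₚ.+-identityʳ _)
    pointwise false true  false b′    = z≤n
    pointwise false true  true  b′    = z≤n
    pointwise true  false false false = ℕₚ.≤-refl
    pointwise true  false false true  = z≤n
    pointwise true  false true  false = ℕₚ.≤-refl
    pointwise true  false true  true  = ℕₚ.≤-refl
    pointwise true  true  false b′    = z≤n
    pointwise true  true  true  false = ℕₚ.≤-refl
    pointwise true  true  true  true  = z≤n

  entering≡cut : ∀ X → entering D X ≡ cut (Vec.lookup X)
  entering≡cut X = trans (length-filter-tabulate (λ e → (head e Subsetₚ.∈? X) ×-dec ¬? (tail e Subsetₚ.∈? X)) id)
    (sum-cong-≗ λ e → cong₂ (λ a b → ⟦ a ∧ not b ⟧) (does-∈? (head e) X) (does-∈? (tail e) X))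

  edgeConnected⇒cut : ∀ {k} → EdgeConnected D k → ∀ A u v → A u ≡ true → A v ≡ false → k ≤ cut A
  edgeConnected⇒cut {k} conn A u v u∈A v∉A =
    subst (k ≤_) (trans (entering≡cut X) (cut-cong (Vecₚ.lookup∘tabulate A)))
      (conn X (u , Vecₚ.lookup⇒[]= u X (trans (Vecₚ.lookup∘tabulate A u) u∈A))
              ((λ _ → Subsetₚ.∈⊤) , v , Subsetₚ.∈⊤ , v∉X))
    where
    X = Vec.tabulate A
    v∉X : v Subset.∉ X
    v∉X p = contradiction (trans (sym (trans (sym (Vecₚ.lookup∘tabulate A v)) (Vecₚ.[]=⇒lookup p))) v∉A) λ ()

  cut⇒edgeConnected : ∀ {k} → (∀ A u v → A u ≡ true → A v ≡ false → k ≤ cut A) → EdgeConnected D k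
  cut⇒edgeConnected {k} cuts X (u , u∈X) (_ , v , _ , v∉X) =
    subst (k ≤_) (sym (entering≡cut X))
      (cuts (Vec.lookup X) u v (Vecₚ.[]=⇒lookup u∈X) (¬true⇒false (v∉X ∘ Vecₚ.lookup⇒[]= v X)))

  ϱ≡headSum : ∀ v → ϱ D v ≡ headSum (λ w → ⟦ does (w Fin.≟ v) ⟧)
  ϱ≡headSum v = length-filter-tabulate (λ e → head e Fin.≟ v) id

  weight-ϱ : ∀ A → weight (ϱ D) A ≡ headSum (⟦_⟧ ∘ A)
  weight-ϱ A = begin
    sum (λ v → if A v then ϱ D v else 0)                                       ≡⟨ sum-cong-≗ expand ⟩
    sum (λ v → sum (λ e → if does (head e Fin.≟ v) then ⟦ A v ⟧ else 0))
      ≡⟨ ∑-comm (λ v e → if does (head e Fin.≟ v) then ⟦ A v ⟧ else 0) ⟩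
    sum (λ e → sum (λ v → if does (head e Fin.≟ v) then ⟦ A v ⟧ else 0))
      ≡⟨ sum-cong-≗ (λ e → sum-δ (head e) (⟦_⟧ ∘ A)) ⟩
    headSum (⟦_⟧ ∘ A)                                                          ∎
    where
    open ≡-Reasoning
    none : ∀ b → (if b then 0 else 0) ≡ 0
    none false = refl
    none true  = refl
    expand : ∀ v → (if A v then ϱ D v else 0) ≡ sum (λ e → if does (head e Fin.≟ v) then ⟦ A v ⟧ else 0)
    expand v with A v
    ... | true  = ϱ≡headSum v
    ... | false = sym (sum-0 (λ e → none (does (head e Fin.≟ v))))

sum-ϱ : ∀ {n m} (D D′ : Digraph n m) → sum (ϱ D) ≡ sum (ϱ D′)
sum-ϱ D D′ = trans (weight-ϱ D (λ _ → true)) (sym (weight-ϱ D′ (λ _ → true)))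

-- Having both ends in `A` does not depend on the direction of the edge.
induced-orientation : ∀ {n m} {G : Graph n m} {D D′} → D IsOrientationOf G → D′ IsOrientationOf G →
                      ∀ A → induced D A ≡ induced D′ A
induced-orientation {D = D} {D′} o o′ A = sum-cong-≗ pointwise
  where
  open Digraph
  pointwise : ∀ e → ⟦ A (head D e) ∧ A (tail D e) ⟧ ≡ ⟦ A (head D′ e) ∧ A (tail D′ e) ⟧
  pointwise e with o e | o′ e
  ... | inj₁ p | inj₁ q = cong (λ (a , b) → ⟦ A b ∧ A a ⟧) (trans (sym p) q)
  ... | inj₂ p | inj₂ q = cong (λ (a , b) → ⟦ A a ∧ A b ⟧) (trans (sym p) q)
  ... | inj₁ p | inj₂ q = trans (cong (λ (a , b) → ⟦ A b ∧ A a ⟧) (trans (sym p) q)) (cong ⟦_⟧ (Boolₚ.∧-comm (A (tail D′ e)) _))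
  ... | inj₂ p | inj₁ q = trans (cong (λ (a , b) → ⟦ A a ∧ A b ⟧) (trans (sym p) q)) (cong ⟦_⟧ (Boolₚ.∧-comm (A (tail D′ e)) _))

-- Reversing a set of arcs

reverse : ∀ {n m} → Digraph n m → (Fin m → Bool) → Digraph n m
reverse D F = record
  { tail = λ e → if F e then head e else tail e
  ; head = λ e → if F e then tail e else head e
  }
  where open Digraph D

reverse-orientation : ∀ {n m} {G : Graph n m} D F → D IsOrientationOf G → reverse D F IsOrientationOf G
reverse-orientation D F o e with F e | o e
... | false | p      = p
... | true  | inj₁ p = inj₂ p
... | true  | inj₂ p = inj₁ p

headSum-reverse : ∀ {n m} (D : Digraph n m) F φ →
                  headSum (reverse D F) φ + sum ((φ ∘ Digraph.head D) ∣ F) ≡ headSum D φ + sum ((φ ∘ Digraph.tail D) ∣ F)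
headSum-reverse D F φ = sum-+-cong (φ ∘ Digraph.head (reverse D F)) ((φ ∘ head) ∣ F) (φ ∘ head) ((φ ∘ tail) ∣ F) pointwise
  where
  open Digraph D
  pointwise : ∀ e → φ (if F e then tail e else head e) + (if F e then φ (head e) else 0)
                  ≡ φ (head e) + (if F e then φ (tail e) else 0)
  pointwise e with F e
  ... | false = refl
  ... | true  = ℕₚ.+-comm (φ (tail e)) _

induced-reverse : ∀ {n m} (D : Digraph n m) F A → induced (reverse D F) A ≡ induced D A
induced-reverse D F A = sum-cong-≗ pointwise
  where
  open Digraph D
  pointwise : ∀ e → ⟦ A (if F e then tail e else head e) ∧ A (if F e then head e else tail e) ⟧ ≡ ⟦ A (head e) ∧ A (tail e) ⟧
  pointwise e with F e
  ... | false = refl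
  ... | true  = cong ⟦_⟧ (Boolₚ.∧-comm (A (tail e)) _)

-- D′ arises from D by moving l units of in-degree from t to s.
Shift : ∀ {n m} → ℕ → Fin n → Fin n → Digraph n m → Digraph n m → Set
Shift l s t D D′ = ∀ φ → headSum D′ φ + l * φ t ≡ headSum D φ + l * φ s

-- The in-degree sum over `A` changes only through `s` and `t`; with `induced` unchanged, the cut
-- changes by the same amount.
shift-cut : ∀ {n m} {l s t} {D D′ : Digraph n m} → Shift l s t D D′ → ∀ A → induced D′ A ≡ induced D A →
            cut D′ A + l * ⟦ A t ⟧ ≡ cut D A + l * ⟦ A s ⟧
shift-cut {l = l} {s} {t} {D} {D′} sh A ind = ℕₚ.+-cancelʳ-≡ (induced D A) _ _ (begin
  (cut D′ A + l * ⟦ A t ⟧) + induced D A   ≡⟨ swap (cut D′ A) (l * ⟦ A t ⟧) (induced D A) ⟩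
  (cut D′ A + induced D A) + l * ⟦ A t ⟧   ≡⟨ cong (λ z → (cut D′ A + z) + l * ⟦ A t ⟧) ind ⟨
  (cut D′ A + induced D′ A) + l * ⟦ A t ⟧  ≡⟨ cong (_+ l * ⟦ A t ⟧) (cut+induced D′ A) ⟩
  headSum D′ (⟦_⟧ ∘ A) + l * ⟦ A t ⟧       ≡⟨ sh (⟦_⟧ ∘ A) ⟩
  headSum D (⟦_⟧ ∘ A) + l * ⟦ A s ⟧        ≡⟨ cong (_+ l * ⟦ A s ⟧) (cut+induced D A) ⟨
  (cut D A + induced D A) + l * ⟦ A s ⟧    ≡⟨ swap (cut D A) (l * ⟦ A s ⟧) (induced D A) ⟨
  (cut D A + l * ⟦ A s ⟧) + induced D A    ∎)
  where
  open ≡-Reasoning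
  swap : ∀ a b c → (a + b) + c ≡ (a + c) + b
  swap = solve 3 (λ a b c → (a :+ b) :+ c := (a :+ c) :+ b) refl

-- Walks

_∈ᵇ_ : ∀ {m} → Fin m → List (Fin m) → Bool
e ∈ᵇ es = does (e ∈? es)
  where open DecMembership Fin._≟_

module _ {m : ℕ} where

  open DecMembership {A = Fin m} Fin._≟_ using (_∈?_)

  ∈ᵇ-true : ∀ {e es} → e ∈ᵇ es ≡ true → e ∈ es
  ∈ᵇ-true {e} {es} eq with yes p ← e ∈? es = p

  ∈⇒∈ᵇ : ∀ {e es} → e ∈ es → e ∈ᵇ es ≡ true
  ∈⇒∈ᵇ {e} {es} p = dec-true (e ∈? es) p

  sum-∣-∈ᵇ : ∀ (c : Fin m → ℕ) {es} → Unique es → sum (c ∣ (_∈ᵇ es)) ≡ ListAction.sum (map c es)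
  sum-∣-∈ᵇ c {[]}     _           = sum-0 {f = c ∣ (_∈ᵇ [])} (λ _ → refl)
  sum-∣-∈ᵇ c {e ∷ es} (e∉es ∷ un) = begin
    sum (c ∣ (_∈ᵇ (e ∷ es)))                                               ≡⟨ sum-cong-≗ pointwise ⟩
    sum (λ j → (if does (e Fin.≟ j) then c j else 0) + (c ∣ (_∈ᵇ es)) j)
      ≡⟨ ∑-distrib-+ (λ j → if does (e Fin.≟ j) then c j else 0) (c ∣ (_∈ᵇ es)) ⟩
    sum (λ j → if does (e Fin.≟ j) then c j else 0) + sum (c ∣ (_∈ᵇ es))   ≡⟨ cong₂ _+_ (sum-δ e c) (sum-∣-∈ᵇ c un) ⟩
    c e + ListAction.sum (map c es)                                              ∎
    where
    open ≡-Reasoning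
    pointwise : ∀ j → (c ∣ (_∈ᵇ (e ∷ es))) j ≡ (if does (e Fin.≟ j) then c j else 0) + (c ∣ (_∈ᵇ es)) j
    pointwise j with e Fin.≟ j | j Fin.≟ e | j ∈? es
    ... | yes refl | yes _  | yes j∈es = contradiction j∈es (Allₚ.All¬⇒¬Any e∉es)
    ... | yes refl | yes _  | no _     = sym (ℕₚ.+-identityʳ _)
    ... | yes p    | no ¬q  | _        = contradiction (sym p) ¬q
    ... | no ¬p    | yes q  | _        = contradiction (sym q) ¬p
    ... | no _     | no _   | _        = refl

module _ {n m} {D : Digraph n m} where

  open Digraph D

  -- The sums telescope: the head of each arc is the tail of the next one, which leaves only the two
  -- ends.
  walk-balance : ∀ (φ : Fin n → ℕ) {s t} (w : Walk D s t) →
                 ListAction.sum (map (φ ∘ head) (arcs D w)) + φ s ≡ ListAction.sum (map (φ ∘ tail) (arcs D w)) + φ t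
  walk-balance φ nil        = refl
  walk-balance φ {t = t} (cons e w) = begin
    (φ (head e) + hs) + φ (tail e)
      ≡⟨ solve 3 (λ a b c → (a :+ b) :+ c := c :+ (b :+ a)) refl (φ (head e)) hs (φ (tail e)) ⟩
    φ (tail e) + (hs + φ (head e))  ≡⟨ cong (φ (tail e) +_) (walk-balance φ w) ⟩
    φ (tail e) + (ts + φ t)         ≡⟨ ℕₚ.+-assoc (φ (tail e)) ts (φ t) ⟨
    (φ (tail e) + ts) + φ t         ∎
    where
    open ≡-Reasoning
    hs = ListAction.sum (map (φ ∘ head) (arcs D w))
    ts = ListAction.sum (map (φ ∘ tail) (arcs D w))

  arc-tail∈nodes : ∀ {s t} (w : Walk D s t) {e} → e ∈ arcs D w → tail e ∈ nodes D w
  arc-tail∈nodes (cons e w) (here refl) = here refl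
  arc-tail∈nodes (cons e w) (there p)   = there (arc-tail∈nodes w p)

  path-arcs-unique : ∀ {s t} (w : Walk D s t) → Unique (nodes D w) → Unique (arcs D w)
  path-arcs-unique nil        _          = []
  path-arcs-unique (cons e w) (e∉ ∷ un) =
    All.tabulate (λ {e′} e′∈w e≡e′ → All.lookup e∉ (arc-tail∈nodes w e′∈w) (cong tail e≡e′)) ∷ path-arcs-unique w un

  path-balance : ∀ φ {s t} ((w , _) : Path D s t) →
                 sum ((φ ∘ head) ∣ (_∈ᵇ arcs D w)) + φ s ≡ sum ((φ ∘ tail) ∣ (_∈ᵇ arcs D w)) + φ t
  path-balance φ {s} {t} (w , un) =
    trans (cong (_+ φ s) (sum-∣-∈ᵇ (φ ∘ head) unique))
      (trans (walk-balance φ w) (cong (_+ φ t) (sym (sum-∣-∈ᵇ (φ ∘ tail) unique))))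
    where unique = path-arcs-unique w un

  reverse-path : ∀ {s t} ((w , _) : Path D s t) → Shift 1 s t D (reverse D (_∈ᵇ arcs D w))
  reverse-path {s} {t} p@(w , _) φ = ℕₚ.+-cancelʳ-≡ (hs + ts) _ _ (begin
    (headSum D′ φ + 1 * φ t) + (hs + ts)
      ≡⟨ solve 4 (λ a b c d → (a :+ con 1 :* b) :+ (c :+ d) := (a :+ c) :+ (d :+ b)) refl (headSum D′ φ) (φ t) hs ts ⟩
    (headSum D′ φ + hs) + (ts + φ t)      ≡⟨ cong₂ _+_ (headSum-reverse D (_∈ᵇ arcs D w) φ) (sym (path-balance φ p)) ⟩
    (headSum D φ + ts) + (hs + φ s)
      ≡⟨ solve 4 (λ a b c d → (a :+ d) :+ (c :+ b) := (a :+ con 1 :* b) :+ (c :+ d)) refl (headSum D φ) (φ s) hs ts ⟩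
    (headSum D φ + 1 * φ s) + (hs + ts)   ∎)
    where
    open ≡-Reasoning
    D′ = reverse D (_∈ᵇ arcs D w)
    hs = sum ((φ ∘ head) ∣ (_∈ᵇ arcs D w))
    ts = sum ((φ ∘ tail) ∣ (_∈ᵇ arcs D w))

  walk-crosses : ∀ (A : NodeSet n) {s t} (w : Walk D s t) → A s ≡ false → A t ≡ true →
                 ∃[ e ] (e ∈ arcs D w × A (head e) ∧ not (A (tail e)) ≡ true)
  walk-crosses A nil        s∉A t∈A = contradiction (trans (sym s∉A) t∈A) λ ()
  walk-crosses A (cons e w) s∉A t∈A with A (head e) in eq
  ... | true  = e , here refl , trans (cong₂ (λ a b → a ∧ not b) eq s∉A) refl
  ... | false with walk-crosses A w eq t∈A
  ...   | e′ , e′∈w , cr = e′ , there e′∈w , cr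

-- The positions of the `ι i` in the list of marked elements give an injection of `Fin l` into the
-- positions of that list.
injective⇒≤-sum : ∀ {l m} (b : Fin m → Bool) (ι : Fin l → Fin m) → (∀ i j → ι i ≡ ι j → i ≡ j) →
                  (∀ i → b (ι i) ≡ true) → l ≤ sum (⟦_⟧ ∘ b)
injective⇒≤-sum {l} {m} b ι inj marked = subst (l ≤_)
  (trans (length-filter-tabulate marked? id) (sum-cong-≗ λ e → cong ⟦_⟧ (does-≟-true (b e))))
  (Finₚ.injective⇒≤ {f = position} λ {i} {j} eq →
     inj i j (trans (Anyₚ.lookup-index (found i)) (trans (cong (List.lookup hits) eq) (sym (Anyₚ.lookup-index (found j))))))
  where
  marked? : ∀ e → Dec (b e ≡ true)
  marked? e = b e Boolₚ.≟ true
  hits : List (Fin m)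
  hits = filter marked? (allFin m)
  found : ∀ i → ι i ∈ hits
  found i = ∈-filter⁺ marked? (∈-allFin (ι i)) (marked i)
  position : Fin l → Fin (length hits)
  position i = index (found i)
  does-≟-true : ∀ b → does (b Boolₚ.≟ true) ≡ b
  does-≟-true false = refl
  does-≟-true true  = refl

-- The easy half of Menger's theorem: each path has an arc entering `A`, and arc-disjointness makes
-- these arcs distinct.
disjointPaths⇒cut : ∀ {n m} {D : Digraph n m} {l s t} → ArcDisjointPaths D l s t →
                    ∀ A → A s ≡ false → A t ≡ true → l ≤ cut D A
disjointPaths⇒cut {D = D} (P , dis) A s∉A t∈A =
  injective⇒≤-sum _ (λ i → proj₁ (crossing i)) inj (λ i → proj₂ (proj₂ (crossing i)))
  where
  crossing = λ i → walk-crosses A (proj₁ (P i)) s∉A t∈A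
  inj : ∀ i j → proj₁ (crossing i) ≡ proj₁ (crossing j) → i ≡ j
  inj i j eq with i Fin.≟ j
  ... | yes p = p
  ... | no ¬p = contradiction (proj₁ (proj₂ (crossing i)) ,
                  subst (_∈ arcs D (proj₁ (P j))) (sym eq) (proj₁ (proj₂ (crossing j)))) (dis i j ¬p)

-- Menger's theorem

-- A backward search from `t` along arcs of `F`: the set of nodes known to reach `t` grows until it
-- contains `s` or no arc of `F` enters it. The number of nodes outside the set bounds the rounds.
search : ∀ {n m} (D : Digraph n m) (F : Fin m → Bool) s t → let open Digraph D in
         (Σ[ p ∈ Path D s t ] All (λ e → F e ≡ true) (arcs D (proj₁ p)))
         ⊎ (Σ[ A ∈ NodeSet n ] (A s ≡ false × A t ≡ true × (∀ e → F e ≡ true → A (head e) ≡ true → A (tail e) ≡ true)))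
search {n} {m} D F s t = go (suc (sum (⟦_⟧ ∘ ∁ start))) start ℕₚ.≤-refl start-t start-path
  where
  open Digraph D

  -- The path is confined to `A`, so prefixing an arc whose tail lies outside `A` cannot repeat a
  -- node.
  Reaching : NodeSet n → Fin n → Set
  Reaching A v = Σ[ w ∈ Walk D v t ]
    (Unique (nodes D w) × All (λ e → F e ≡ true) (arcs D w) × All (λ v → A v ≡ true) (nodes D w))

  start : NodeSet n
  start v = does (t Fin.≟ v)

  start-t : start t ≡ true
  start-t = dec-true (t Fin.≟ t) refl

  start-path : ∀ v → start v ≡ true → Reaching start v
  start-path v v∈ with yes refl ← t Fin.≟ v = nil , [] ∷ [] , [] , start-t ∷ []

  go : ∀ fuel A → sum (⟦_⟧ ∘ ∁ A) < fuel → A t ≡ true → (∀ v → A v ≡ true → Reaching A v) →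
       (Σ[ p ∈ Path D s t ] All (λ e → F e ≡ true) (arcs D (proj₁ p)))
       ⊎ (Σ[ A ∈ NodeSet n ] (A s ≡ false × A t ≡ true × (∀ e → F e ≡ true → A (head e) ≡ true → A (tail e) ≡ true)))
  go (suc fuel) A small t∈A reach with A s in s∈A
  ... | true  with w , un , inF , _ ← reach s s∈A = inj₁ ((w , un) , inF)
  ... | false with Finₚ.any? (λ e → (F e ∧ (A (head e) ∧ not (A (tail e)))) Boolₚ.≟ true)
  ...   | no none = inj₂ (A , s∈A , t∈A , closed)
    where
    closed : ∀ e → F e ≡ true → A (head e) ≡ true → A (tail e) ≡ true
    closed e e∈F h∈A with A (tail e) in eq
    ... | true  = refl
    ... | false = contradiction (e , ∧-true e∈F (∧-true h∈A (cong not eq))) none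
  ...   | yes (e , enters) = go fuel B (ℕₚ.<-≤-trans shrinks (ℕₚ.≤-pred small)) (∨-introˡ _ t∈A) reach′
    where
    B : NodeSet n
    B v = A v ∨ does (tail e Fin.≟ v)
    e∈F : F e ≡ true
    e∈F = ∧-elimˡ enters
    h∈A : A (head e) ≡ true
    h∈A = ∧-elimˡ (∧-elimʳ {F e} enters)
    t∉A : A (tail e) ≡ false
    t∉A = not-true (∧-elimʳ {A (head e)} (∧-elimʳ {F e} enters))
    e∈B : B (tail e) ≡ true
    e∈B = ∨-introʳ (A (tail e)) (dec-true (tail e Fin.≟ tail e) refl)
    A⊆B : ∀ {v} → A v ≡ true → B v ≡ true
    A⊆B = ∨-introˡ _
    shrinks : sum (⟦_⟧ ∘ ∁ B) < sum (⟦_⟧ ∘ ∁ A)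
    shrinks = sum-mono-< (λ v → le (A v) _) (tail e)
                (subst₂ (λ a b → ⟦ not b ⟧ < ⟦ not a ⟧) (sym t∉A) (sym e∈B) ℕₚ.≤-refl)
      where
      le : ∀ a b → ⟦ not (a ∨ b) ⟧ ≤ ⟦ not a ⟧
      le true  b     = z≤n
      le false false = ℕₚ.≤-refl
      le false true  = z≤n
    reach′ : ∀ v → B v ≡ true → Reaching B v
    reach′ v v∈B with A v in eq
    ... | true  with w , un , inF , inA ← reach v eq = w , un , inF , All.map A⊆B inA
    ... | false with yes refl ← tail e Fin.≟ v | w , un , inF , inA ← reach (head e) h∈A =
          cons e w ,
          All.map (λ {v} v∈A e≡v → contradiction (trans (sym v∈A) (trans (cong A (sym e≡v)) t∉A)) λ ()) inA ∷ un ,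
          e∈F ∷ inF , e∈B ∷ All.map A⊆B inA

module _ {n m} (D : Digraph n m) where

  open Digraph D

  -- Ford-Fulkerson augmentation, with `reverse D F` as the residual digraph of the flow `F`. If it
  -- has no path from `s` to `t`, then some set containing `t` but not `s` has no entering arc in
  -- it, hence exactly `l` entering arcs in `D`, one too few. Otherwise an augmenting path is
  -- reversed.
  augment : ∀ {s t} l → (∀ A → A s ≡ false → A t ≡ true → l ≤ cut D A) → ∃[ F ] Shift l s t D (reverse D F)
  augment zero    cuts = (λ _ → false) , λ φ → refl
  augment {s} {t} (suc l) cuts with augment l (λ A s∉A t∈A → ℕₚ.<⇒≤ (cuts A s∉A t∈A))
  ... | F , sh with search (reverse D F) (λ _ → true) s t
  ...   | inj₂ (A , s∉A , t∈A , closed) = contradiction (cuts A s∉A t∈A) (ℕₚ.<⇒≱ (s≤s (ℕₚ.≤-reflexive saturated)))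
    where
    D′ = reverse D F
    none : ∀ e → ⟦ A (Digraph.head D′ e) ∧ not (A (Digraph.tail D′ e)) ⟧ ≡ 0
    none e with A (Digraph.head D′ e) in eq
    ... | false = refl
    ... | true  = cong (λ b → ⟦ not b ⟧) (closed e refl eq)
    saturated : cut D A ≡ l
    saturated = begin
      cut D A                        ≡⟨ solve 2 (λ a b → a := a :+ b :* con 0) refl (cut D A) l ⟩
      cut D A + l * 0                ≡⟨ cong (λ b → cut D A + l * ⟦ b ⟧) s∉A ⟨
      cut D A + l * ⟦ A s ⟧          ≡⟨ shift-cut {l = l} {s} {t} {D} {D′} sh A (induced-reverse D F A) ⟨
      cut D′ A + l * ⟦ A t ⟧         ≡⟨ cong₂ (λ a b → a + l * ⟦ b ⟧) (sum-0 none) t∈A ⟩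
      l * 1                          ≡⟨ ℕₚ.*-identityʳ l ⟩
      l                              ∎
      where
      open ≡-Reasoning
  -- An arc reversed twice regains its old direction, hence `xor`.
  ...   | inj₁ (p@(w , _) , _) = (λ e → F e xor (e ∈ᵇ arcs D′ w)) , shift
    where
    D′ = reverse D F
    D″ = reverse D′ (_∈ᵇ arcs D′ w)
    twice : ∀ (φ : Fin n → ℕ) e → φ (if F e xor (e ∈ᵇ arcs D′ w) then tail e else head e) ≡ φ (Digraph.head D″ e)
    twice φ e with F e | e ∈ᵇ arcs D′ w
    ... | false | false = refl
    ... | false | true  = refl
    ... | true  | false = refl
    ... | true  | true  = refl
    shift : Shift (suc l) s t D (reverse D (λ e → F e xor (e ∈ᵇ arcs D′ w)))
    shift φ = begin
      headSum (reverse D (λ e → F e xor (e ∈ᵇ arcs D′ w))) φ + suc l * φ t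
        ≡⟨ cong (_+ suc l * φ t) (sum-cong-≗ (twice φ)) ⟩
      headSum D″ φ + suc l * φ t
        ≡⟨ solve 3 (λ a b c → a :+ (b :+ c) := (a :+ con 1 :* b) :+ c) refl (headSum D″ φ) (φ t) (l * φ t) ⟩
      (headSum D″ φ + 1 * φ t) + l * φ t  ≡⟨ cong (_+ l * φ t) (reverse-path {D = D′} p φ) ⟩
      (headSum D′ φ + 1 * φ s) + l * φ t
        ≡⟨ solve 3 (λ a b c → (a :+ con 1 :* b) :+ c := (a :+ c) :+ b) refl (headSum D′ φ) (φ s) (l * φ t) ⟩
      (headSum D′ φ + l * φ t) + φ s      ≡⟨ cong (_+ φ s) (sh φ) ⟩
      (headSum D φ + l * φ s) + φ s
        ≡⟨ solve 3 (λ a b c → (a :+ c) :+ b := a :+ (b :+ c)) refl (headSum D φ) (φ s) (l * φ s) ⟩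
      headSum D φ + suc l * φ s           ∎
      where
      open ≡-Reasoning

  -- `F` is a 0-1 flow of value `l` from `s` to `t`: with `φ` the indicator of a node, the equation
  -- is the conservation law at that node.
  Flow : (Fin m → Bool) → ℕ → Fin n → Fin n → Set
  Flow F l s t = ∀ φ → sum ((φ ∘ head) ∣ F) + l * φ s ≡ sum ((φ ∘ tail) ∣ F) + l * φ t

  shift⇒flow : ∀ {F l s t} → Shift l s t D (reverse D F) → Flow F l s t
  shift⇒flow {F} {l} {s} {t} sh φ = ℕₚ.+-cancelʳ-≡ (headSum D φ) _ _ (begin
    (hs + l * φ s) + headSum D φ
      ≡⟨ solve 3 (λ a b c → (a :+ b) :+ c := a :+ (c :+ b)) refl hs (l * φ s) (headSum D φ) ⟩
    hs + (headSum D φ + l * φ s)     ≡⟨ cong (hs +_) (sh φ) ⟨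
    hs + (headSum D′ φ + l * φ t)
      ≡⟨ solve 3 (λ a b c → a :+ (b :+ c) := (b :+ a) :+ c) refl hs (headSum D′ φ) (l * φ t) ⟩
    (headSum D′ φ + hs) + l * φ t    ≡⟨ cong (_+ l * φ t) (headSum-reverse D F φ) ⟩
    (headSum D φ + ts) + l * φ t
      ≡⟨ solve 3 (λ a b c → (a :+ b) :+ c := (b :+ c) :+ a) refl (headSum D φ) ts (l * φ t) ⟩
    (ts + l * φ t) + headSum D φ     ∎)
    where
    open ≡-Reasoning
    D′ = reverse D F
    hs = sum ((φ ∘ head) ∣ F)
    ts = sum ((φ ∘ tail) ∣ F)

  -- Paths are peeled off one by one: removing the arcs of a path lowers the value by one, and later
  -- paths use only the remaining arcs. A path exists, since otherwise a set containing `t` but not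
  -- `s` would have no entering arc of `F`, although a positive net flow has to enter it.
  decompose : ∀ {s t} l F → Flow F l s t →
              Σ[ (P , _) ∈ ArcDisjointPaths D l s t ] (∀ i → All (λ e → F e ≡ true) (arcs D (proj₁ (P i))))
  decompose zero F flow = ((λ ()) , λ ()) , λ ()
  decompose {s} {t} (suc l) F flow with search D F s t
  ... | inj₂ (A , s∉A , t∈A , closed) = contradiction (flow (⟦_⟧ ∘ A)) (ℕₚ.<⇒≢ (ℕₚ.+-mono-≤-< heads≤tails bigger))
    where
    heads≤tails : sum ((⟦_⟧ ∘ A ∘ head) ∣ F) ≤ sum ((⟦_⟧ ∘ A ∘ tail) ∣ F)
    heads≤tails = sum-mono-≤ pointwise
      where
      pointwise : ∀ e → ((⟦_⟧ ∘ A ∘ head) ∣ F) e ≤ ((⟦_⟧ ∘ A ∘ tail) ∣ F) e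
      pointwise e with F e in e∈F | A (head e) in h∈A
      ... | false | _     = z≤n
      ... | true  | false = z≤n
      ... | true  | true  = subst (λ b → 1 ≤ ⟦ b ⟧) (sym (closed e e∈F h∈A)) ℕₚ.≤-refl
    bigger : suc l * ⟦ A s ⟧ < suc l * ⟦ A t ⟧
    bigger = subst₂ (λ a b → suc l * ⟦ a ⟧ < suc l * ⟦ b ⟧) (sym s∉A) (sym t∈A)
               (subst (_< suc l * 1) (sym (ℕₚ.*-zeroʳ l)) (s≤s z≤n))
  ... | inj₁ (p@(w , _) , w⊆F) with decompose l (F ∖ R) flow′
    where
    R : Fin m → Bool
    R e = e ∈ᵇ arcs D w
    split : ∀ c → sum (c ∣ F) ≡ sum (c ∣ (F ∖ R)) + sum (c ∣ R)
    split c = trans (sum-cong-≗ pointwise) (∑-distrib-+ (c ∣ (F ∖ R)) (c ∣ R))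
      where
      pointwise : ∀ e → (c ∣ F) e ≡ (c ∣ (F ∖ R)) e + (c ∣ R) e
      pointwise e with F e in e∈F | R e in e∈R
      ... | false | false = refl
      ... | true  | false = sym (ℕₚ.+-identityʳ _)
      ... | true  | true  = refl
      ... | false | true  = contradiction (trans (sym (All.lookup w⊆F (∈ᵇ-true e∈R))) e∈F) λ ()
    flow′ : Flow (F ∖ R) l s t
    flow′ φ = ℕₚ.+-cancelʳ-≡ (sum ((φ ∘ head) ∣ R) + φ s) _ _ (begin
      (h + l * φ s) + (hR + φ s)
        ≡⟨ solve 4 (λ a b c d → (a :+ b) :+ (c :+ d) := (a :+ c) :+ (d :+ b)) refl h (l * φ s) hR (φ s) ⟩
      (h + hR) + suc l * φ s       ≡⟨ cong (_+ suc l * φ s) (split (φ ∘ head)) ⟨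
      sum ((φ ∘ head) ∣ F) + suc l * φ s  ≡⟨ flow φ ⟩
      sum ((φ ∘ tail) ∣ F) + suc l * φ t  ≡⟨ cong (_+ suc l * φ t) (split (φ ∘ tail)) ⟩
      (k + kR) + suc l * φ t
        ≡⟨ solve 4 (λ a b c d → (a :+ b) :+ (c :+ d) := (a :+ d) :+ (b :+ c)) refl k kR (φ t) (l * φ t) ⟩
      (k + l * φ t) + (kR + φ t)   ≡⟨ cong ((k + l * φ t) +_) (path-balance φ p) ⟨
      (k + l * φ t) + (hR + φ s)   ∎)
      where
      open ≡-Reasoning
      h = sum ((φ ∘ head) ∣ (F ∖ R))
      hR = sum ((φ ∘ head) ∣ R)
      k = sum ((φ ∘ tail) ∣ (F ∖ R))
      kR = sum ((φ ∘ tail) ∣ R)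
  ...   | (P , dis) , P⊆ = (P′ , dis′) , P′⊆F
    where
    P′ : Fin (suc l) → Path D s t
    P′ zero    = p
    P′ (suc i) = P i
    P′⊆F : ∀ i → All (λ e → F e ≡ true) (arcs D (proj₁ (P′ i)))
    P′⊆F zero    = w⊆F
    P′⊆F (suc i) = All.map ∧-elimˡ (P⊆ i)
    apart : ∀ i → Disjoint (arcs D w) (arcs D (proj₁ (P i)))
    apart i {e} (e∈w , e∈P) =
      contradiction (trans (sym (not-true (∧-elimʳ {F e} (All.lookup (P⊆ i) e∈P)))) (∈⇒∈ᵇ e∈w)) λ ()
    dis′ : ∀ i j → i ≢ j → Disjoint (arcs D (proj₁ (P′ i))) (arcs D (proj₁ (P′ j)))
    dis′ zero    zero    i≢j         = contradiction refl i≢j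
    dis′ zero    (suc j) _           = apart j
    dis′ (suc i) zero    _ (p , q)   = apart i (q , p)
    dis′ (suc i) (suc j) i≢j         = dis i j (i≢j ∘ cong suc)

  menger : ∀ {s t} l → (∀ A → A s ≡ false → A t ≡ true → l ≤ cut D A) → ArcDisjointPaths D l s t
  menger {s} {t} l cuts =
    let F , sh = augment l cuts in proj₁ (decompose l F (shift⇒flow {F} {l} {s} {t} sh))

-- Bounds with infinite values

open import Data.Integer using (ℤ; +_)

private
  variable
    a b : ℕ
    α : ℤ ₋
    β : ℤ ⁺

<₋⇒≤₋ : α <₋ [ + suc a ] → α ≤₋ [ + a ]
<₋⇒≤₋ ⊥₋<[ _ ] = ≤₋.⊥₋≤ _
<₋⇒≤₋ [ p ]    = ≤₋.[ ℤₚ.i<j⇒i≤pred[j] p ]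

≤₋-trans : α ≤₋ [ + a ] → a ≤ b → α ≤₋ [ + b ]
≤₋-trans (≤₋.⊥₋≤ _) _ = ≤₋.⊥₋≤ _
≤₋-trans ≤₋.[ p ]   q = ≤₋.[ ℤₚ.≤-trans p (ℤ.+≤+ q) ]

≤₋-<-trans : α ≤₋ [ + a ] → a < b → α <₋ [ + b ]
≤₋-<-trans (≤₋.⊥₋≤ _) _ = ⊥₋<[ _ ]
≤₋-<-trans ≤₋.[ p ]   q = [ ℤₚ.≤-<-trans p (ℤ.+<+ q) ]

<⁺⇒≤⁺ : [ + a ] <⁺ β → [ + suc a ] ≤⁺ β
<⁺⇒≤⁺ <⁺.[ _ ]<⊤⁺ = _ ≤⁺.≤⊤⁺
<⁺⇒≤⁺ <⁺.[ p ]    = ≤⁺.[ ℤₚ.i<j⇒suc[i]≤j p ]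

≤⁺-trans : a ≤ b → [ + b ] ≤⁺ β → [ + a ] ≤⁺ β
≤⁺-trans _ (_ ≤⁺.≤⊤⁺) = _ ≤⁺.≤⊤⁺
≤⁺-trans q ≤⁺.[ p ]   = ≤⁺.[ ℤₚ.≤-trans (ℤ.+≤+ q) p ]

<-≤⁺-trans : a < b → [ + b ] ≤⁺ β → [ + a ] <⁺ β
<-≤⁺-trans _ (_ ≤⁺.≤⊤⁺) = <⁺.[ _ ]<⊤⁺
<-≤⁺-trans q ≤⁺.[ p ]   = <⁺.[ ℤₚ.<-≤-trans (ℤ.+<+ q) p ]

-- Performing a transfer on a vector

transfer : ∀ {n} (y : Fin n → ℕ) u v → Fin n → ℕ
transfer y u v w = if does (w Fin.≟ u) then suc (y w) else if does (w Fin.≟ v) then pred (y w) else y w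

-- `y u < y v` serves twice: `u` and `v` differ, and `y v` is positive, so that `pred` really
-- subtracts one.
transfer-isTransfer : ∀ {n} (y : Fin n → ℕ) {u v} → y u < y v → Transfer y (transfer y u v) u v
transfer-isTransfer y {u} {v} lt = record { gain = gain ; loss = loss ; other = other }
  where
  gain : transfer y u v u ≡ suc (y u)
  gain rewrite dec-true (u Fin.≟ u) refl = refl
  loss : suc (transfer y u v v) ≡ y v
  loss rewrite dec-false (v Fin.≟ u) (λ v≡u → ℕₚ.<-irrefl (cong y (sym v≡u)) lt) | dec-true (v Fin.≟ v) refl =
    ℕₚ.suc-pred (y v) {{>-nonZero (ℕₚ.≤-<-trans z≤n lt)}}
  other : ∀ w → w ≢ u → w ≢ v → transfer y u v w ≡ y w
  other w w≢u w≢v rewrite dec-false (w Fin.≟ u) w≢u | dec-false (w Fin.≟ v) w≢v = refl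

module _ {n} {y y′ : Fin n → ℕ} {u v : Fin n} (u≢v : u ≢ v) (tr : Transfer y y′ u v) where

  open Transfer tr

  transfer-weight : ∀ A → weight y′ A + ⟦ A v ⟧ ≡ weight y A + ⟦ A u ⟧
  transfer-weight A = ℕₚ.+-cancelʳ-≡ ((y ∣ A) u + (y′ ∣ A) v) _ _ (begin
    (weight y′ A + ⟦ A v ⟧) + ((y ∣ A) u + (y′ ∣ A) v)
      ≡⟨ solve 4 (λ a b c d → (a :+ b) :+ (c :+ d) := a :+ (c :+ (d :+ b))) refl (weight y′ A) ⟦ A v ⟧ ((y ∣ A) u) ((y′ ∣ A) v) ⟩
    weight y′ A + ((y ∣ A) u + ((y′ ∣ A) v + ⟦ A v ⟧))
      ≡⟨ cong (λ z → weight y′ A + ((y ∣ A) u + z)) (at y′ y v (trans (ℕₚ.+-comm (y′ v) 1) loss)) ⟩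
    weight y′ A + ((y ∣ A) u + (y ∣ A) v)
      ≡⟨ sum-update₂ u v u≢v (λ w w≢u w≢v → cong (λ z → if A w then z else 0) (other w w≢u w≢v)) ⟩
    weight y A + ((y′ ∣ A) u + (y′ ∣ A) v)
      ≡⟨ cong (λ z → weight y A + (z + (y′ ∣ A) v)) (at y y′ u (trans (ℕₚ.+-comm (y u) 1) (sym gain))) ⟨
    weight y A + (((y ∣ A) u + ⟦ A u ⟧) + (y′ ∣ A) v)
      ≡⟨ solve 4 (λ a b c d → a :+ ((c :+ b) :+ d) := (a :+ b) :+ (c :+ d)) refl (weight y A) ⟦ A u ⟧ ((y ∣ A) u) ((y′ ∣ A) v) ⟩
    (weight y A + ⟦ A u ⟧) + ((y ∣ A) u + (y′ ∣ A) v)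
      ∎)
    where
    open ≡-Reasoning
    at : ∀ (y y′ : Fin n → ℕ) w → y w + 1 ≡ y′ w → (y ∣ A) w + ⟦ A w ⟧ ≡ (y′ ∣ A) w
    at _ _ w eq with A w
    ... | true  = eq
    ... | false = refl

  transfer-sum : sum y′ ≡ sum y
  transfer-sum = ℕₚ.+-cancelʳ-≡ 1 _ _ (transfer-weight (λ _ → true))

  transfer-cases : ∀ (P : Fin n → Set) → P u → P v → (∀ w → y′ w ≡ y w → P w) → ∀ w → P w
  transfer-cases P Pu Pv Po w with w Fin.≟ u | w Fin.≟ v
  ... | yes refl | _        = Pu
  ... | no _     | yes refl = Pv
  ... | no w≢u   | no w≢v   = Po w (other w w≢u w≢v)

-- Local optimality implies decreasing minimality

-- `Down` and `Up` abstract the strict inequalities with `f` and `g`, and `local` abstracts the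
-- absence of an improving pair.
module Descent {n} {T : NodeSet n → Set} (crossing : CrossingFamily T) (T? : ∀ A → Dec (T A))
               (x : Fin n → ℕ) (Down Up : Fin n → Set)
               (local : ∀ {u v} → Down u → Up v → ¬ (∃[ X ] (T X × X u ≡ true × X v ≡ false)) → x u ≤ suc (x v)) where

  open CrossingFamily crossing

  private

    -- Node sets are functions, so the finite search runs over subsets given as vectors, and `P` may
    -- depend only on values. Decidability turns the negative conclusion of `exchange` into an
    -- actual node `v`.
    ∃Set? : ∀ {P : NodeSet n → Set} → (∀ {A B} → A ≗ B → P A → P B) → (∀ A → Dec (P A)) → Dec (∃[ A ] P A)
    ∃Set? P-resp P? = map′ (λ (X , p) → Vec.lookup X , p)
                           (λ (A , p) → Vec.tabulate A , P-resp (λ v → sym (Vecₚ.lookup∘tabulate A v)) p)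
                           (Subsetₚ.anySubset? (λ X → P? (Vec.lookup X)))

    Separates : Fin n → Fin n → NodeSet n → Set
    Separates u v X = T X × X u ≡ true × X v ≡ false

    separates? : ∀ u v → Dec (∃[ X ] Separates u v X)
    separates? u v = ∃Set? (λ A≗B (TA , p , q) → respects A≗B TA , trans (sym (A≗B u)) p , trans (sym (A≗B v)) q)
                           (λ X → T? X ×-dec (X u Boolₚ.≟ true) ×-dec (X v Boolₚ.≟ false))

    blocked? : ∀ y u v → Dec (∃[ Y ] (T Y × weight y Y ≤ weight x Y × Y v ≡ true × Y u ≡ false))
    blocked? y u v =
      ∃Set? (λ A≗B (TA , le , p , q) → respects A≗B TA , subst₂ _≤_ (weight-cong y A≗B) (weight-cong x A≗B) le ,
                                       trans (sym (A≗B v)) p , trans (sym (A≗B u)) q)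
            (λ Y → T? Y ×-dec (weight y Y ≤? weight x Y) ×-dec (Y v Boolₚ.≟ true) ×-dec (Y u Boolₚ.≟ false))

  record Above (y : Fin n → ℕ) : Set where
    field
      total : sum x ≡ sum y
      above : ∀ {A} → T A → weight x A ≤ weight y A
      -- For a competitor, `f w ≤ y w < x w` provides this slack; `up` is the same with `g`.
      down  : ∀ w → y w < x w → Down w
      up    : ∀ w → x w < y w → Up w

  -- Induction on the total deficit of `y` below `x`. Without a deficit, equal totals force the
  -- vectors to coincide. Otherwise a unit moves to `u`, which lowers the deficit, from a node `v`
  -- whose entry stays at least `x v`.
  minimal : ∀ {y} → Above y → x ≤dec y
  minimal {y} ab = go (suc (sum (λ w → x w ∸ y w))) y ℕₚ.≤-refl ab
    where
    go : ∀ fuel y → sum (λ w → x w ∸ y w) < fuel → Above y → x ≤dec y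
    go (suc fuel) y small ab with Finₚ.any? (λ u → y u <? x u)
    ... | no none = ≤dec-reflexive (sum-≤⇒≗ (λ u → ℕₚ.≮⇒≥ (λ lt → none (u , lt))) (Above.total ab))
    ... | yes (u , u↓) with Finₚ.any? (λ v → (x v <? y v) ×-dec ¬? (separates? u v ⊎-dec blocked? y u v))
    ...   | no none = contradiction
              (λ v v↑ → decidable-stable (separates? u v ⊎-dec blocked? y u v) (λ ¬s → none (v , v↑ , ¬s)))
              (Exchange.exchange crossing x y (Above.total ab) (Above.above ab) u u↓)
    ...   | yes (v , v↑ , free) =
            ≤dec-trans {y = y′} (go fuel y′ (ℕₚ.<-≤-trans closer (ℕₚ.≤-pred small)) ab′) (transfer-≤dec tr u<v)
      where
      open Above ab
      u<v : y u < y v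
      u<v = ℕₚ.<-≤-trans u↓ (ℕₚ.≤-trans (local (down u u↓) (up v v↑) (free ∘ inj₁)) v↑)
      u≢v : u ≢ v
      u≢v refl = ℕₚ.<-irrefl refl u<v
      y′ : Fin n → ℕ
      y′ = transfer y u v
      tr : Transfer y y′ u v
      tr = transfer-isTransfer y u<v
      open Transfer tr
      x≤y′v : x v ≤ y′ v
      x≤y′v = ℕₚ.≤-pred (subst (x v <_) (sym loss) v↑)
      closer : sum (λ w → x w ∸ y′ w) < sum (λ w → x w ∸ y w)
      closer = sum-mono-<
        (transfer-cases u≢v tr (λ w → x w ∸ y′ w ≤ x w ∸ y w) (ℕₚ.<⇒≤ at-u)
          (subst (_≤ x v ∸ y v) (sym (ℕₚ.m≤n⇒m∸n≡0 x≤y′v)) z≤n)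
          (λ w eq → ℕₚ.≤-reflexive (cong (x w ∸_) eq)))
        u at-u
        where
        at-u : x u ∸ y′ u < x u ∸ y u
        at-u = subst (λ z → x u ∸ z < x u ∸ y u) (sym gain) (ℕₚ.∸-monoʳ-< (ℕₚ.n<1+n (y u)) u↓)
      above′ : ∀ {A} → T A → weight x A ≤ weight y′ A
      above′ {A} TA with A u in eu | A v in ev | transfer-weight u≢v tr A
      ... | false | false | eq = subst (weight x A ≤_) (sym (ℕₚ.+-cancelʳ-≡ 0 _ _ eq)) (above TA)
      ... | true  | true  | eq = subst (weight x A ≤_) (sym (ℕₚ.+-cancelʳ-≡ 1 _ _ eq)) (above TA)
      ... | true  | false | eq = ℕₚ.≤-trans (above TA)
                                   (ℕₚ.≤-trans (ℕₚ.m≤m+n _ 1) (ℕₚ.≤-reflexive (trans (sym eq) (ℕₚ.+-identityʳ _))))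
      -- Here `A` loses a unit, but as it does not block the move, its inequality was strict before.
      ... | false | true  | eq = ℕₚ.≤-pred (ℕₚ.≤-trans (ℕₚ.≰⇒> (λ le → free (inj₂ (A , TA , le , ev , eu))))
                                   (ℕₚ.≤-reflexive (trans (sym (ℕₚ.+-identityʳ _)) (trans (sym eq) (ℕₚ.+-comm _ 1)))))
      ab′ : Above y′
      ab′ = record
        { total = trans total (sym (transfer-sum u≢v tr))
        ; above = above′
        ; down  = transfer-cases u≢v tr (λ w → y′ w < x w → Down w) (λ _ → down u u↓)
                    (λ lt → contradiction x≤y′v (ℕₚ.<⇒≱ lt)) (λ w eq lt → down w (subst (_< x w) eq lt))
        ; up    = transfer-cases u≢v tr (λ w → x w < y′ w → Up w)
                    (λ lt → contradiction (subst (x u <_) gain lt) (ℕₚ.≤⇒≯ u↓))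
                    (λ _ → up v v↑) (λ w eq lt → up w (subst (x w <_) eq lt))
        }

-- Tight sets

module _ {n m} (D : Digraph n m) (k : ℕ) where

  -- For a `k`-edge-connected `D` the inequality is an equality, as the set is non-empty and proper.
  Tight : NodeSet n → Set
  Tight A = cut D A ≤ k × (∃[ u ] A u ≡ true) × (∃[ v ] A v ≡ false)

  tight? : ∀ A → Dec (Tight A)
  tight? A = (cut D A ≤? k) ×-dec Finₚ.any? (λ u → A u Boolₚ.≟ true) ×-dec Finₚ.any? (λ v → A v Boolₚ.≟ false)

  -- Submodularity bounds the cuts of the union and the intersection together by `k + k`. Each of
  -- them is at least `k` by connectivity, so neither exceeds `k`.
  tight-crossing : EdgeConnected D k → CrossingFamily Tight
  tight-crossing conn = record
    { respects = λ A≗B (le , (u , p) , (v , q)) →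
        subst (_≤ k) (cut-cong D A≗B) le , (u , trans (sym (A≗B u)) p) , (v , trans (sym (A≗B v)) q)
    ; ∪-closed = λ {A} {B} u v TA TB u∈ v∉ →
        ℕₚ.+-cancelʳ-≤ k _ _ (ℕₚ.≤-trans (ℕₚ.+-monoʳ-≤ _ (k≤∩ {A} {B} u∈ v∉)) (both TA TB)) ,
        (u , ∨-introˡ (B u) (∧-elimˡ {A u} u∈)) , (v , v∉)
    ; ∩-closed = λ {A} {B} u v TA TB u∈ v∉ →
        ℕₚ.+-cancelˡ-≤ k _ _ (ℕₚ.≤-trans (ℕₚ.+-monoˡ-≤ _ (k≤∪ {A} {B} u∈ v∉)) (both TA TB)) ,
        (u , u∈) , (v , cong (_∧ B v) (∨-falseˡ v∉))
    }
    where
    k≤∩ : ∀ {A B u v} → A u ∧ B u ≡ true → A v ∨ B v ≡ false → k ≤ cut D (A ∩ B)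
    k≤∩ {A} {B} {u} {v} u∈ v∉ = edgeConnected⇒cut D conn (A ∩ B) u v u∈ (cong (_∧ B v) (∨-falseˡ v∉))
    k≤∪ : ∀ {A B u v} → A u ∧ B u ≡ true → A v ∨ B v ≡ false → k ≤ cut D (A ∪ B)
    k≤∪ {A} {B} {u} {v} u∈ v∉ = edgeConnected⇒cut D conn (A ∪ B) u v (∨-introˡ (B u) (∧-elimˡ {A u} u∈)) v∉
    both : ∀ {A B} → Tight A → Tight B → cut D (A ∪ B) + cut D (A ∩ B) ≤ k + k
    both {A} {B} (a , _) (b , _) = ℕₚ.≤-trans (cut-submodular D A B) (ℕₚ.+-mono-≤ a b)

  -- A set violating the cut condition of Menger's theorem would be a tight set separating `t` from
  -- `s`.
  unseparated⇒paths : ∀ {s t} → ¬ (∃[ X ] (Tight X × X t ≡ true × X s ≡ false)) → ArcDisjointPaths D (suc k) s t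
  unseparated⇒paths {s} {t} none = menger D (suc k) λ A s∉A t∈A →
    ℕₚ.≰⇒> (λ le → none (A , (le , (t , t∈A) , (s , s∉A)) , t∈A , s∉A))

-- Reversing one path of an orientation

module _ {n m} {D : Digraph n m} {s t : Fin n} (s≢t : s ≢ t) where

  reverse-path-transfer : ∀ (p : Path D s t) → Transfer (ϱ D) (ϱ (reverse D (_∈ᵇ arcs D (proj₁ p)))) s t
  reverse-path-transfer p = record
    { gain  = at s (dec-false (t Fin.≟ s) (s≢t ∘ sym)) (dec-true (s Fin.≟ s) refl)
    ; loss  = at t (dec-true (t Fin.≟ t) refl) (dec-false (s Fin.≟ t) s≢t)
    ; other = λ w w≢s w≢t → at w (dec-false (t Fin.≟ w) (w≢t ∘ sym)) (dec-false (s Fin.≟ w) (w≢s ∘ sym))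
    }
    where
    D′ = reverse D (_∈ᵇ arcs D (proj₁ p))
    -- The shift identity is evaluated on the indicator function of `w`.
    at : ∀ w {a b} → does (t Fin.≟ w) ≡ a → does (s Fin.≟ w) ≡ b → ⟦ a ⟧ + ϱ D′ w ≡ ⟦ b ⟧ + ϱ D w
    at w refl refl = begin
      ⟦ does (t Fin.≟ w) ⟧ + ϱ D′ w
        ≡⟨ solve 2 (λ a b → a :+ b := b :+ con 1 :* a) refl ⟦ does (t Fin.≟ w) ⟧ (ϱ D′ w) ⟩
      ϱ D′ w + 1 * ⟦ does (t Fin.≟ w) ⟧       ≡⟨ cong (_+ 1 * ⟦ does (t Fin.≟ w) ⟧) (ϱ≡headSum D′ w) ⟩
      headSum D′ δ + 1 * δ t                  ≡⟨ reverse-path p δ ⟩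
      headSum D δ + 1 * δ s                   ≡⟨ cong (_+ 1 * ⟦ does (s Fin.≟ w) ⟧) (ϱ≡headSum D w) ⟨
      ϱ D w + 1 * ⟦ does (s Fin.≟ w) ⟧
        ≡⟨ solve 2 (λ a b → b :+ con 1 :* a := a :+ b) refl ⟦ does (s Fin.≟ w) ⟧ (ϱ D w) ⟩
      ⟦ does (s Fin.≟ w) ⟧ + ϱ D w            ∎
      where
      open ≡-Reasoning
      δ : Fin n → ℕ
      δ z = ⟦ does (z Fin.≟ w) ⟧

  -- Only sets containing `t` but not `s` lose entering arcs, and they lose exactly one; the `k + 1`
  -- disjoint paths guarantee that they have one to spare.
  reverse-path-connected : ∀ {k} → EdgeConnected D k → ((P , _) : ArcDisjointPaths D (suc k) s t) →
                           EdgeConnected (reverse D (_∈ᵇ arcs D (proj₁ (P zero)))) k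
  reverse-path-connected {k} conn paths@(P , _) = cut⇒edgeConnected D′ cuts
    where
    F = _∈ᵇ arcs D (proj₁ (P zero))
    D′ = reverse D F
    cuts : ∀ A u v → A u ≡ true → A v ≡ false → k ≤ cut D′ A
    cuts A u v u∈A v∉A
      with A t in t∈A | A s in s∈A | shift-cut {l = 1} {s} {t} {D} {D′} (reverse-path (P zero)) A (induced-reverse D F A)
    ... | false | _     | eq = ℕₚ.≤-trans (edgeConnected⇒cut D conn A u v u∈A v∉A)
                                 (ℕₚ.≤-trans (ℕₚ.m≤m+n _ _) (ℕₚ.≤-reflexive (trans (sym eq) (ℕₚ.+-identityʳ _))))
    ... | true  | true  | eq = subst (k ≤_) (sym (ℕₚ.+-cancelʳ-≡ 1 _ _ eq)) (edgeConnected⇒cut D conn A u v u∈A v∉A)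
    ... | true  | false | eq = ℕₚ.≤-pred (ℕₚ.≤-trans (disjointPaths⇒cut paths A s∈A t∈A)
                                 (ℕₚ.≤-reflexive (trans (sym (ℕₚ.+-identityʳ _)) (trans (sym eq) (ℕₚ.+-comm _ 1)))))

transfer-bounded : ∀ {n m} {D D′ : Digraph n m} {f g s t} → s ≢ t → Transfer (ϱ D) (ϱ D′) s t → Bounded D f g →
                   f t <₋ [ + ϱ D t ] → [ + ϱ D s ] <⁺ g s → Bounded D′ f g
transfer-bounded {D = D} {D′} {f} {g} {s} {t} s≢t tr bd ft gs =
  transfer-cases s≢t tr (λ v → (f v ≤₋ [ + ϱ D′ v ]) × ([ + ϱ D′ v ] ≤⁺ g v))
    (≤₋-trans (proj₁ (bd s)) (subst (ϱ D s ≤_) (sym gain) (ℕₚ.n≤1+n _)) ,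
     subst (λ z → [ + z ] ≤⁺ g s) (sym gain) (<⁺⇒≤⁺ gs))
    (<₋⇒≤₋ (subst (λ z → f t <₋ [ + z ]) (sym loss) ft) ,
     ≤⁺-trans (subst (ϱ D′ t ≤_) loss (ℕₚ.n≤1+n _)) (proj₂ (bd t)))
    (λ v eq → subst (λ z → (f v ≤₋ [ + z ]) × ([ + z ] ≤⁺ g v)) (sym eq) (bd v))
  where open Transfer tr

-- The two directions of the characterization

Improvable : ∀ {n m} → ℕ → (Fin n → ℤ ₋) → (Fin n → ℤ ⁺) → Digraph n m → Set
Improvable k f g D =
  ∃[ s ] ∃[ t ] (ϱ D t ≥ ϱ D s + 2 × f t <₋ [ + ϱ D t ] × [ + ϱ D s ] <⁺ g s × ArcDisjointPaths D (suc k) s t)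

module _ {n m} {G : Graph n m} {k : ℕ} {f : Fin n → ℤ ₋} {g : Fin n → ℤ ⁺} {D : Digraph n m} where

  decMin⇒¬improvable : DecMin (Feasible G k f g) D → ¬ Improvable k f g D
  decMin⇒¬improvable (feas , least) (s , t , gap , ft , gs , paths@(P , _)) =
    transfer-strict tr gap′ (least D′ record
      { isOrientation = reverse-orientation D _ isOrientation
      ; edgeConnected = reverse-path-connected s≢t edgeConnected paths
      ; bounded       = transfer-bounded {D = D} {D′} s≢t tr bounded ft gs
      })
    where
    open Feasible feas
    gap′ : suc (ϱ D s) < ϱ D t
    gap′ = subst (_≤ ϱ D t) (ℕₚ.+-comm (ϱ D s) 2) gap
    s≢t : s ≢ t
    s≢t refl = ℕₚ.<-asym gap′ (ℕₚ.n<1+n _)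
    D′ = reverse D (_∈ᵇ arcs D (proj₁ (P zero)))
    tr : Transfer (ϱ D) (ϱ D′) s t
    tr = reverse-path-transfer s≢t (P zero)

  ¬improvable⇒decMin : Feasible G k f g D → ¬ Improvable k f g D → DecMin (Feasible G k f g) D
  ¬improvable⇒decMin feas stuck = feas , λ D′ feas′ → minimal (above-feasible feas′)
    where
    open Feasible feas
    open Descent (tight-crossing D k edgeConnected) (tight? D k) (ϱ D)
                 (λ u → f u <₋ [ + ϱ D u ]) (λ v → [ + ϱ D v ] <⁺ g v)
                 (λ {u} {v} fu gv none → ℕₚ.≮⇒≥ λ lt →
                    -- A gap of two would make `v` and `u`, in the roles of `s` and `t`, an
                    -- improving pair.
                    stuck (v , u , subst (_≤ ϱ D u) (ℕₚ.+-comm 2 (ϱ D v)) lt , fu , gv , unseparated⇒paths D k none))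

    above-feasible : ∀ {D′} → Feasible G k f g D′ → Above (ϱ D′)
    above-feasible {D′} feas′ = record
      { total = sum-ϱ D D′
      -- A set tight in `D` has at least as many entering arcs in the competitor, and both
      -- orientations induce equally many arcs in it, so the inequality passes from cuts to weights.
      ; above = λ {A} (le , (u , u∈A) , (v , v∉A)) →
          subst₂ _≤_ (trans (cut+induced D A) (sym (weight-ϱ D A))) (trans (cut+induced D′ A) (sym (weight-ϱ D′ A)))
            (ℕₚ.+-mono-≤ (ℕₚ.≤-trans le (edgeConnected⇒cut D′ (Feasible.edgeConnected feas′) A u v u∈A v∉A))
                         (ℕₚ.≤-reflexive (induced-orientation isOrientation (Feasible.isOrientation feas′) A)))
      ; down  = λ w → ≤₋-<-trans (proj₁ (Feasible.bounded feas′ w))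
      ; up    = λ w lt → <-≤⁺-trans lt (proj₂ (Feasible.bounded feas′ w))
      }

theorem6p8 : ∀ {n m : ℕ} (G : Graph n m) (k : ℕ) → 1 ≤ k →
    (f : Fin n → ℤ ₋) (g : Fin n → ℤ ⁺) → (∀ v → f v ≤∞ g v) →
    (D : Digraph n m) → Feasible G k f g D →
    DecMin (Feasible G k f g) D ⇔
    (¬ (∃[ s ] ∃[ t ] (ϱ D t ≥ ϱ D s + 2 × f t <₋ [ + ϱ D t ] × [ + ϱ D s ] <⁺ g s × ArcDisjointPaths D (suc k) s t)))
theorem6p8 G k _ f g _ D feas = mk⇔ decMin⇒¬improvable (¬improvable⇒decMin feas)
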